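{- Let $r\geq 3$, let $P$ be an $r$-pattern, and let $v$ be a vertex of $P$ such that some maximal weighting of $P$ assigns $v$ positive weight. Suppose that $\lambda\left(\mathrm{FR}_v(P)\right)=\lambda(P)$ and $r!\,\lambda(P)<1$, and let $\alpha=r!\,\lambda(P)$. Then: (i) if $r=3$, then $\alpha\geq\frac{6}{121}\left(5\sqrt5-2\right)$; and (ii) if $r\geq 4$, then $\alpha\geq\frac{2\,r!}{r^r}$.
   Context: An $r$-pattern $P=(V(P),E(P))$ consists of a finite vertex set $V(P)$ and a set $E(P)$ of edges, each of which is a multiset of size $r$ on $V(P)$. For an edge $e$, $m_e(v)$ denotes the multiplicity of $v$ in $e$. Lagrangian: a weighting $w$ of $V(P)$ assigns to each vertex $v$ a real weight $w(v)\ge 0$ with $\sum_{v}w(v)=1$. Put $w(e)=\prod_{v\in V(P)}\frac{w(v)^{m_e(v)}}{m_e(v)!}$ for each edge $e$, $w(P)=\sum_{e\in E(P)}w(e)$, and $\lambda(P)=\max\{w(P): w \text{ a weighting of } V(P)\}$. A weighting attaining this maximum is called a maximal weighting of $P$. Blow-up: given positive integers $\mathbf{k}=(k_u)_{u\in V(P)}$, the blow-up $P(\mathbf{k})$ is the $r$-pattern with vertex set $\{(u,i):u\in V(P),1\le i\le k_u\}$ in which the multiset $(u_1,i_1)\dots(u_r,i_r)$ is an edge if and only if the multiset $u_1\dots u_r$ is an edge of $P$. Frankl–Rödl construction: for $v\in V(P)$, set $k_v=r$ and $k_u=1$ for all other vertices $u$. Let $P'$ be the $r$-pattern on the vertex set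 of $P(\mathbf{k})$ with edge set $E(P')=\{e\in E(P(\mathbf{k})): m_e((v,i))\le 1 \text{ for all } i\in\{2,\dots,r\}\}$. Then $\mathrm{FR}_v(P)$ is the $r$-pattern obtained from $P'$ by adding the single edge $\{(v,1),(v,2),\dots,(v,r)\}$. -}

module Defs where

open import Level using (Level; 0ℓ; _⊔_) renaming (suc to lsuc)
open import Algebra.Apartness.Bundles using (HeytingField; HeytingCommutativeRing)
import Algebra.Apartness.Properties.HeytingCommutativeRing as HeytingProperties
open import Algebra.Bundles using (CommutativeRing; Semiring)
import Algebra.Definitions.RawMonoid as RawMonoidDefinitions
import Algebra.Definitions.RawSemiring as RawSemiringDefinitions
import Algebra.Properties.CommutativeMonoid.Sum as Sum
import Algebra.Properties.Ring as RingProperties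
open import Data.Bool.Base using (Bool; true; false; if_then_else_)
open import Data.Fin.Base using (Fin; zero; suc; toℕ; _↑ˡ_; _↑ʳ_)
open import Data.Fin.Properties using (_≟_; all?)
open import Data.List.Base as List using (List; []; _∷_)
open import Data.List.Membership.Propositional using (_∈_)
open import Data.List.Membership.Propositional.Properties
  using (∈-map⁺; ∈-map⁻; ∈-concatMap⁺; ∈-upTo⁺)
open import Data.List.Relation.Binary.Disjoint.Propositional using (Disjoint)
import Data.List.Relation.Unary.All as All
import Data.List.Relation.Unary.All.Properties as All
open import Data.List.Relation.Unary.Any as Any using (here)
open import Data.List.Relation.Unary.AllPairs as AllPairs using ([]; _∷_)
import Data.List.Relation.Unary.AllPairs.Properties as AllPairs
open import Data.List.Relation.Unary.Unique.Propositional using (Unique)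
open import Data.List.Relation.Unary.Unique.Propositional.Properties
  using (map⁺; concat⁺; upTo⁺)
open import Data.Nat.Base as ℕ using (ℕ; zero; suc; NonZero; _!)
import Data.Nat.Properties as ℕ
open import Data.Product.Base using (∃-syntax; _×_; _,_; proj₁; proj₂)
open import Data.Sum.Base using (_⊎_; inj₁; inj₂; [_,_]′)
open import Data.Vec.Base as Vec using (Vec; []; _∷_; lookup; tabulate; _++_)
import Data.Vec.Properties as Vec
open import Data.Vec.Functional using (Vector)
open import Function.Base using (_∘_)
open import Relation.Binary.Core using (Rel)
open import Relation.Binary.PropositionalEquality as ≡
  using (_≡_; _≢_; refl; cong; module ≡-Reasoning)
open import Relation.Binary.Structures using (IsStrictPartialOrder)
open import Relation.Nullary using (¬_; does)
open import Relation.Nullary.Decidable using (_×-dec_; _⊎-dec_; _→-dec_)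
open import Relation.Unary using (Pred; Decidable)

-- ℝ is given by its characterisation as a Cauchy-complete Archimedean
-- ordered field.  No decidability is assumed, so that the axioms hold for
-- constructive as well as for classical reals.

record RealNumbers (c ℓ₁ ℓ₂ : Level) : Set (lsuc (c ⊔ ℓ₁ ⊔ ℓ₂)) where
  field
    heytingField : HeytingField c ℓ₁ ℓ₂

  open HeytingField heytingField public
  open HeytingCommutativeRing heytingCommutativeRing public
    using (commutativeRing)
  open CommutativeRing commutativeRing public
    using (ring; semiring)
  open Semiring semiring public
    using (rawSemiring)
  open RawSemiringDefinitions rawSemiring public
    using (_^_; sum; product)
    renaming (_×_ to _·_)

  ι : ℕ → Carrier
  ι n = n · 1#

  infix 4 _<_ _≤_

  field
    _<_                  : Rel Carrier ℓ₂
    isStrictPartialOrder : IsStrictPartialOrder _≈_ _<_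
    <⇒#                  : ∀ {x y} → x < y → x # y
    #⇒<⊎>                : ∀ {x y} → x # y → x < y ⊎ y < x
    +-monoʳ-<            : ∀ z {x y} → x < y → z + x < z + y
    *-pos                : ∀ {x y} → 0# < x → 0# < y → 0# < x * y

  open IsStrictPartialOrder isStrictPartialOrder public
    using (<-resp-≈; <-respʳ-≈; <-respˡ-≈)
    renaming (irrefl to <-irrefl; trans to <-trans; asym to <-asym)

  _≤_ : Rel Carrier ℓ₂
  x ≤ y = ¬ (y < x)

  -- The differences are bounded in both directions because the roles of
  -- m and n can be interchanged.
  IsCauchy : (ℕ → Carrier) → Set ℓ₂
  IsCauchy x = ∀ k → ∃[ N ] ∀ m n → N ℕ.≤ m → N ℕ.≤ n →
                 ι (suc k) * (x m - x n) < 1#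

  _ConvergesTo_ : (ℕ → Carrier) → Carrier → Set ℓ₂
  x ConvergesTo l = ∀ k → ∃[ N ] ∀ n → N ℕ.≤ n →
                      (ι (suc k) * (x n - l) < 1#) ×
                      (ι (suc k) * (l - x n) < 1#)

  field
    archimedean : ∀ x → ∃[ n ] x < ι n
    complete    : ∀ x → IsCauchy x → ∃[ l ] x ConvergesTo l

  private
    module HP = HeytingProperties heytingCommutativeRing
    module RP = RingProperties ring

  0<1 : 0# < 1#
  0<1 with #⇒<⊎> HP.1#0
  ... | inj₂ 0<1 = 0<1
  ... | inj₁ 1<0 = <-respʳ-≈ -1*-1≈1 (*-pos 0<-1 0<-1)
    where
    0<-1 : 0# < - 1#
    0<-1 = <-respˡ-≈ (-‿inverseˡ 1#)
             (<-respʳ-≈ (+-identityʳ (- 1#)) (+-monoʳ-< (- 1#) 1<0))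

    -1*-1≈1 : - 1# * - 1# ≈ 1#
    -1*-1≈1 = trans (RP.-1*x≈-x (- 1#)) (RP.-‿involutive 1#)

  0<ι[1+n] : ∀ n → 0# < ι (suc n)
  0<ι[1+n] zero    = <-respʳ-≈ (sym (+-identityʳ 1#)) 0<1
  0<ι[1+n] (suc n) = <-trans 0<1
    (<-respˡ-≈ (+-identityʳ 1#) (+-monoʳ-< 1# (0<ι[1+n] n)))

  infixl 7 _/_

  _/_ : Carrier → (d : ℕ) .{{_ : NonZero d}} → Carrier
  x / suc d = x * proj₁ (#⇒invertible (#-sym (<⇒# (0<ι[1+n] d))))

  ι*/ : ∀ x d .{{_ : NonZero d}} → ι d * (x / d) ≈ x
  ι*/ x d@(suc d-1) = begin
    ι d * (x * d⁻¹)       ≈⟨ *-congˡ (*-comm x d⁻¹) ⟩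
    ι d * (d⁻¹ * x)       ≈⟨ *-assoc (ι d) d⁻¹ x ⟨
    ι d * d⁻¹ * x         ≈⟨ *-congʳ (*-congʳ (HP.x-0≈x (ι d))) ⟨
    (ι d - 0#) * d⁻¹ * x  ≈⟨ *-congʳ (proj₂ (proj₂ inverse)) ⟩
    1# * x                ≈⟨ *-identityˡ x ⟩
    x                     ∎
    where
    open import Relation.Binary.Reasoning.Setoid setoid
    inverse = #⇒invertible (#-sym (<⇒# (0<ι[1+n] d-1)))
    d⁻¹ = proj₁ inverse

  IsSqrt : Carrier → Carrier → Set (ℓ₁ ⊔ ℓ₂)
  IsSqrt a s = (0# ≤ s) × (s * s ≈ a)

-- A multiset on Fin n is its vector of multiplicities: m_e(v) = lookup e v.

private
  module ℕ∑ = Sum ℕ.+-0-commutativeMonoid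

open ℕ∑ using (sum-syntax)

Multiset : ℕ → Set
Multiset n = Vec ℕ n

size : ∀ {n} → Multiset n → ℕ
size {n} e = ∑[ v < n ] lookup e v

multisets : (n r : ℕ) → List (Multiset n)
multisets zero    zero    = [] ∷ []
multisets zero    (suc _) = []
multisets (suc n) r       =
  List.concatMap (λ m → List.map (m ∷_) (multisets n (r ℕ.∸ m)))
                 (List.upTo (suc r))

-- The list above contains every multiset of size r exactly once, so that
-- summing over it is summing over a set of multisets.

∈-multisets : ∀ {n} r (e : Multiset n) → size e ≡ r → e ∈ multisets n r
∈-multisets _ []      refl = here refl
∈-multisets r (m ∷ e) refl =
  ∈-concatMap⁺ (λ m′ → List.map (m′ ∷_) (multisets _ (r ℕ.∸ m′)))
    (Any.map (λ { refl → ∈-map⁺ (m ∷_)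
                   (∈-multisets _ e (≡.sym (ℕ.m+n∸m≡n m (size e)))) })
             (∈-upTo⁺ (ℕ.s≤s (ℕ.m≤m+n m (size e)))))

multisets-unique : (n r : ℕ) → Unique (multisets n r)
multisets-unique zero    zero    = All.[] ∷ []
multisets-unique zero    (suc _) = []
multisets-unique (suc n) r       = concat⁺
  (All.map⁺ (All.universal
    (λ m → map⁺ Vec.∷-injectiveʳ (multisets-unique n (r ℕ.∸ m))) _))
  (AllPairs.map⁺ (AllPairs.map disjoint (upTo⁺ (suc r))))
  where
  disjoint : ∀ {l m} → l ≢ m →
             Disjoint (List.map (l ∷_) (multisets n (r ℕ.∸ l)))
                      (List.map (m ∷_) (multisets n (r ℕ.∸ m)))
  disjoint l≢m (e∈l , e∈m)
    with _ , _ , refl ← ∈-map⁻ (_ ∷_) e∈l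
    with _ , _ , refl ← ∈-map⁻ (_ ∷_) e∈m = l≢m refl

record Pattern (r : ℕ) : Set₁ where
  field
    order   : ℕ
    Edge    : Pred (Multiset order) 0ℓ
    edge?   : Decidable Edge
    uniform : ∀ {e} → Edge e → size e ≡ r

  Vertex : Set
  Vertex = Fin order

  edges : List (Multiset order)
  edges = List.filter edge? (multisets order r)

module Lagrangian {c ℓ₁ ℓ₂} (ℝ : RealNumbers c ℓ₁ ℓ₂) where
  open RealNumbers ℝ

  module _ {r} (P : Pattern r) where
    open Pattern P

    IsWeighting : Vector Carrier order → Set (ℓ₁ ⊔ ℓ₂)
    IsWeighting w = (∀ v → 0# ≤ w v) × (sum w ≈ 1#)

    edgeWeight : Vector Carrier order → Multiset order → Carrier
    edgeWeight w e = product λ v →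
      _/_ (w v ^ lookup e v) (lookup e v !) {{ lookup e v ℕ.!≢0 }}

    weight : Vector Carrier order → Carrier
    weight w = List.foldr _+_ 0# (List.map (edgeWeight w) edges)

    -- The relation λ(P) = l: the maximum is attained and equals l.
    IsLagrangian : Carrier → Set (c ⊔ ℓ₁ ⊔ ℓ₂)
    IsLagrangian l = (∃[ w ] IsWeighting w × weight w ≈ l) ×
                     (∀ w → IsWeighting w → weight w ≤ l)

    IsMaximalWeighting : Vector Carrier order → Set (c ⊔ ℓ₁ ⊔ ℓ₂)
    IsMaximalWeighting w = IsWeighting w ×
                           (∀ w′ → IsWeighting w′ → weight w′ ≤ weight w)

-- The pairs (u , i) with i < k u are numbered consecutively by
-- Fin (∑[ u < n ] k u); copy k u i is the number of (u , i), where i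
-- counts from 0.

copy : ∀ {n} (k : Fin n → ℕ) (u : Fin n) → Fin (k u) → Fin (∑[ u < n ] k u)
copy {suc n} k zero    i = i ↑ˡ (∑[ u < n ] k (suc u))
copy {suc n} k (suc u) i = k zero ↑ʳ copy (k ∘ suc) u i

-- The vector whose entry at (u , i) is f u i.
spread : ∀ {a} {A : Set a} {n} (k : Fin n → ℕ) →
         (∀ u → Fin (k u) → A) → Vec A (∑[ u < n ] k u)
spread {n = zero}  k f = []
spread {n = suc n} k f = tabulate (f zero) ++ spread (k ∘ suc) (f ∘ suc)

lookup-spread : ∀ {a} {A : Set a} {n} (k : Fin n → ℕ)
                (f : ∀ u → Fin (k u) → A) u i →
                lookup (spread k f) (copy k u i) ≡ f u i
lookup-spread k f zero    i = ≡.trans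
  (Vec.lookup-++ˡ (tabulate (f zero)) _ i) (Vec.lookup∘tabulate (f zero) i)
lookup-spread k f (suc u) i = ≡.trans
  (Vec.lookup-++ʳ (tabulate (f zero)) _ (copy (k ∘ suc) u i))
  (lookup-spread (k ∘ suc) (f ∘ suc) u i)

-- The multiset u₁ … u_r underlying (u₁ , i₁) … (u_r , i_r).
project : ∀ {n} (k : Fin n → ℕ) →
          Multiset (∑[ u < n ] k u) → Multiset n
project k e = tabulate λ u → ∑[ i < k u ] lookup e (copy k u i)

∑-split : ∀ m {n} (f : Fin (m ℕ.+ n) → ℕ) →
          ∑[ i < m ℕ.+ n ] f i ≡
          ∑[ i < m ] f (i ↑ˡ n) ℕ.+ ∑[ j < n ] f (m ↑ʳ j)
∑-split zero    f = refl
∑-split (suc m) f = ≡.trans (cong (f zero ℕ.+_) (∑-split m (f ∘ suc)))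
                            (≡.sym (ℕ.+-assoc (f zero) _ _))

∑-copy : ∀ {n} (k : Fin n → ℕ) (f : Fin (∑[ u < n ] k u) → ℕ) →
         ∑[ x < (∑[ u < n ] k u) ] f x ≡
         ∑[ u < n ] ∑[ i < k u ] f (copy k u i)
∑-copy {zero}  k f = refl
∑-copy {suc n} k f = ≡.trans (∑-split (k zero) f)
  (cong (∑[ i < k zero ] f (copy k zero i) ℕ.+_)
        (∑-copy (k ∘ suc) (f ∘ (k zero ↑ʳ_))))

size-project : ∀ {n} (k : Fin n → ℕ) e → size (project k e) ≡ size e
size-project k e = ≡.trans
  (ℕ∑.sum-cong-≗ (Vec.lookup∘tabulate λ u → ∑[ i < k u ] lookup e (copy k u i)))
  (≡.sym (∑-copy k (lookup e)))

blowUp : ∀ {r} (P : Pattern r) → (Pattern.Vertex P → ℕ) → Pattern r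
blowUp P k = record
  { order   = ∑[ u < order ] k u
  ; Edge    = λ e → Edge (project k e)
  ; edge?   = λ e → edge? (project k e)
  ; uniform = λ {e} E → ≡.trans (≡.sym (size-project k e)) (uniform E)
  }
  where open Pattern P

module FranklRödl {r} (P : Pattern r) (v : Pattern.Vertex P) where
  open Pattern P

  k : Vertex → ℕ
  k u = if does (u ≟ v) then r else 1

  module P[k] = Pattern (blowUp P k)

  -- The vertices (v , 2) , … , (v , r) are the copy k v i with 1 ≤ toℕ i.
  Edge′ : Pred (Multiset P[k].order) 0ℓ
  Edge′ e = P[k].Edge e ×
            (∀ i → 1 ℕ.≤ toℕ i → lookup e (copy k v i) ℕ.≤ 1)

  edge′? : Decidable Edge′
  edge′? e = P[k].edge? e ×-dec
    all? λ i → (1 ℕ.≤? toℕ i) →-dec (lookup e (copy k v i) ℕ.≤? 1)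

  -- The set {(v , 1) , … , (v , r)}.
  newEdge : Multiset P[k].order
  newEdge = spread k λ u _ → if does (u ≟ v) then 1 else 0

  size-newEdge : size newEdge ≡ r
  size-newEdge = begin
    size newEdge
      ≡⟨ ∑-copy k (lookup newEdge) ⟩
    ∑[ u < order ] ∑[ i < k u ] lookup newEdge (copy k u i)
      ≡⟨ ℕ∑.sum-cong-≗ (λ u → ℕ∑.sum-cong-≗ (lookup-spread k _ u)) ⟩
    ∑[ u < order ] ∑[ _ < k u ] (if does (u ≟ v) then 1 else 0)
      ≡⟨ ℕ∑.sum-cong-≗ (λ u → count (does (u ≟ v))) ⟩
    ∑[ u < order ] (if does (u ≟ v) then r else 0)
      ≡⟨ ∑-indicator v ⟩
    r ∎
    where
    open ≡-Reasoning

    count : ∀ b → ∑[ _ < (if b then r else 1) ] (if b then 1 else 0) ≡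
                  (if b then r else 0)
    count true  = ≡.trans (ℕ∑.sum-replicate r) (×-one r)
      where
      open RawMonoidDefinitions ℕ.+-0-rawMonoid renaming (_×_ to _·_)
      ×-one : ∀ n → n · 1 ≡ n
      ×-one zero    = refl
      ×-one (suc n) = cong suc (×-one n)
    count false = refl

    ∑-indicator : ∀ {n} (v : Fin n) →
                  ∑[ u < n ] (if does (u ≟ v) then r else 0) ≡ r
    ∑-indicator {suc n} zero    = ≡.trans
      (cong (r ℕ.+_) (ℕ∑.sum-replicate-zero n)) (ℕ.+-identityʳ r)
    ∑-indicator {suc n} (suc v) = ∑-indicator v

  FR : Pattern r
  FR = record
    { order   = P[k].order
    ; Edge    = λ e → Edge′ e ⊎ e ≡ newEdge
    ; edge?   = λ e → edge′? e ⊎-dec Vec.≡-dec ℕ._≟_ e newEdge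
    ; uniform = λ {e} → [ P[k].uniform {e} ∘ proj₁ , (λ { refl → size-newEdge }) ]′
    }

open FranklRödl public using (FR)

{-# OPTIONS --safe #-}
module Submission where

-- If every edge had multiplicity at most 1 at v, then dividing the weight of v
-- in a maximal weighting equally among the r copies of v would preserve the
-- weight of P and gain that of the new edge, contradicting λ(FR) = λ(P).
-- Hence some edge e has m_e(v) ≥ 2.
--
-- The weighting u ↦ m_e(u) / r gives λ(P) ≥ r⁻ʳ ∏ m_e(u)^m_e(u) / m_e(u)!, where
-- every factor is at least 1 and the factor of v is at least 2.  This is (ii).
-- If m_e(v) = r it even gives α ≥ 1.
--
-- So for r = 3 there remains e = {v,v,u}.  Weights a, t, t on the copies of v
-- and y on u show that λ(FR) ≥ W = a²y/2 + 2aty + t²y + at².  The maximum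
-- over a + 2t + y = 1 is at t = (2√5 - 3)/11, a = (7 - √5)/11,
-- y = (10 - 3√5)/11, where 6W = 6/121 (5√5 - 2).

open import Defs
open import Algebra.Bundles using (CommutativeMonoid; CommutativeRing)
open import Algebra.Bundles.Raw using (RawRing)
import Algebra.Properties.CommutativeMonoid.Sum as Sum
open import Algebra.Properties.CommutativeSemigroup using (x∙yz≈y∙xz)
import Algebra.Solver.Ring as RingSolver
open import Algebra.Solver.Ring.AlmostCommutativeRing
  using (fromCommutativeSemiring; _-Raw-AlmostCommutative⟶_)
open import Data.Bool.Base using (true; false; if_then_else_)
open import Data.Fin.Base using (Fin; zero; suc; toℕ; cast; _↑ˡ_; _↑ʳ_)
open import Data.Fin.Patterns using (0F; 1F; 2F)
open import Data.Fin.Properties using (_≟_; suc-injective; toℕ-cast; toℕ-injective)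
open import Data.List.Base as List using (List; []; _∷_; _++_; concatMap)
open import Data.List.Membership.Propositional using (_∈_; find; lose)
open import Data.List.Membership.Propositional.Properties
  using (∈-∃++; ∈-++⁺ˡ; ∈-++⁺ʳ; ∈-++⁻; ∈-tabulate⁻; ∈-concatMap⁻; ∈-filter⁺; ∈-filter⁻)
open import Data.List.Relation.Binary.Disjoint.Propositional using (Disjoint)
open import Data.List.Relation.Unary.All as All using (All; []; _∷_)
import Data.List.Relation.Unary.All.Properties as All
open import Data.List.Relation.Unary.AllPairs as AllPairs using ([]; _∷_)
import Data.List.Relation.Unary.AllPairs.Properties as AllPairs
open import Data.List.Relation.Unary.Any as Any using (here; there)
open import Data.List.Relation.Unary.Unique.Propositional using (Unique)
open import Data.List.Relation.Unary.Unique.Propositional.Properties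
  using (tabulate⁺; concat⁺; filter⁺)
open import Data.Maybe.Base as Maybe using (Maybe)
open import Data.Nat.Base as ℕ using (ℕ; zero; suc; _!; >-nonZero)
open import Data.Nat.Properties as ℕ using (m^n≢0; ≤-trans)
open import Data.Product.Base using (_×_; _,_; ∃-syntax; proj₁; proj₂)
open import Data.Sum.Base using (_⊎_; inj₁; inj₂; [_,_]′)
open import Data.Vec.Base using (Vec; lookup)
open import Data.Vec.Properties using (tabulate-cong; tabulate∘lookup)
import Data.Vec.Relation.Unary.All as VecAll
import Data.Vec.Relation.Unary.All.Properties as VecAll
open import Function.Base using (_∘_; id)
open import Level using (Level)
open import Relation.Binary.Bundles using (Preorder)
open import Relation.Binary.Consequences using (dec⇒weaklyDec)
open import Relation.Binary.PropositionalEquality as ≡ using (_≡_; _≢_)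
open import Relation.Nullary using (Dec; yes; no; does; contradiction)
open import Relation.Nullary.Decidable using (dec-true; dec-false)

-- The order on the reals is not decidable: `x ≤ y` means `¬ (y < x)`, and no step may decide which
-- of two reals is larger. The case distinctions that drive the argument therefore concern
-- multiplicities in edges, which are natural numbers in a finite list. All lower bounds on weights
-- have one form: a duplicate-free list of edges weighs at most as much as the whole pattern. The
-- lists are the new edge with the clones of all edges of P, a single edge, and five edges arising
-- from {v,v,u}. The point (a, t, y) comes from equating the derivatives of W in a and in y with
-- half of that in t. For t > 0 this amounts to a = y + t and a² = 2at + 4t². With a + 2t + y = 1 it
-- becomes a = (1 - t)/2, y = (1 - 3t)/2 and 11t² + 6t = 1, whose positive root is t.

module ℕ∑ = Sum ℕ.+-0-commutativeMonoid

-- Finite sums in a commutative monoid, used for both sums and products.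

module FiniteSum {a ℓ} (M : CommutativeMonoid a ℓ) where
  open CommutativeMonoid M
  open Sum M using (sum; sum-cong-≋; sum-replicate-zero)
  open import Relation.Binary.Reasoning.Setoid setoid

  -- Covers every change of a sum at one index. The change is the summand `x`, because a monoid has
  -- no subtraction.
  sum-adjust : ∀ {n} (v : Fin n) (f g : Fin n → Carrier) x →
               (∀ u → u ≢ v → f u ≈ g u) → x ∙ f v ≈ g v →
               x ∙ sum f ≈ sum g
  sum-adjust zero f g x eq eqv =
    trans (sym (assoc _ _ _)) (∙-cong eqv (sum-cong-≋ λ u → eq (suc u) λ ()))
  sum-adjust (suc v) f g x eq eqv = begin
    x ∙ (f zero ∙ sum (f ∘ suc))  ≈⟨ assoc _ _ _ ⟨
    x ∙ f zero ∙ sum (f ∘ suc)    ≈⟨ ∙-congʳ (comm _ _) ⟩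
    f zero ∙ x ∙ sum (f ∘ suc)    ≈⟨ assoc _ _ _ ⟩
    f zero ∙ (x ∙ sum (f ∘ suc))  ≈⟨ ∙-cong (eq zero λ ()) (sum-adjust v (f ∘ suc) (g ∘ suc) x
                                       (λ u u≢v → eq (suc u) (u≢v ∘ suc-injective)) eqv) ⟩
    sum g                         ∎

  sum-single : ∀ {n} (v : Fin n) (f : Fin n → Carrier) →
               (∀ u → u ≢ v → f u ≈ ε) → sum f ≈ f v
  sum-single {n} v f eq = begin
    sum f                    ≈⟨ sum-adjust v (λ _ → ε) f (f v) (λ u → sym ∘ eq u) (identityʳ _) ⟨
    f v ∙ sum {n} (λ _ → ε)  ≈⟨ ∙-congˡ (sum-replicate-zero n) ⟩
    f v ∙ ε                  ≈⟨ identityʳ _ ⟩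
    f v                      ∎

  sum-pull : ∀ {n} (v : Fin n) (f : Fin n → Carrier) →
             f v ∙ sum (λ u → if does (u ≟ v) then ε else f u) ≈ sum f
  sum-pull v f = sum-adjust v _ f (f v) off on
    where
    off : ∀ u → u ≢ v → (if does (u ≟ v) then ε else f u) ≈ f u
    off u u≢v with u ≟ v
    ... | yes u≡v = contradiction u≡v u≢v
    ... | no  _   = refl

    on : f v ∙ (if does (v ≟ v) then ε else f v) ≈ f v
    on with v ≟ v
    ... | yes _   = identityʳ _
    ... | no  v≢v = contradiction ≡.refl v≢v

  sum-split : ∀ m {n} (f : Fin (m ℕ.+ n) → Carrier) →
              sum f ≈ sum (λ i → f (i ↑ˡ n)) ∙ sum (λ j → f (m ↑ʳ j))
  sum-split zero    f = sym (identityˡ _)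
  sum-split (suc m) f = trans (∙-congˡ (sum-split m (f ∘ suc))) (sym (assoc _ _ _))

  sum-copy : ∀ {n} (k : Fin n → ℕ) (f : Fin (ℕ∑.sum k) → Carrier) →
             sum f ≈ sum λ u → sum λ i → f (copy k u i)
  sum-copy {zero}  k f = refl
  sum-copy {suc n} k f = trans (sum-split (k zero) f)
    (∙-congˡ (sum-copy (k ∘ suc) (f ∘ (k zero ↑ʳ_))))

-- Factorials against powers, and indicator functions on ℕ.

n!≤n^n : ∀ n → n ! ℕ.≤ n ℕ.^ n
n!≤n^n zero    = ℕ.≤-refl
n!≤n^n (suc n) = ℕ.*-monoʳ-≤ (suc n)
  (ℕ.≤-trans (n!≤n^n n) (ℕ.^-monoˡ-≤ n (ℕ.n≤1+n n)))

-- The base case n = 2 is an equality: the constant 2 of part (ii) is the value of m^m / m! at m =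
-- 2.
2*n!≤n^n : ∀ {n} → 2 ℕ.≤ n → 2 ℕ.* n ! ℕ.≤ n ℕ.^ n
2*n!≤n^n {1}                   (ℕ.s≤s ())
2*n!≤n^n {2}                   _ = ℕ.≤-refl
2*n!≤n^n {suc n@(suc (suc _))} _ = begin
  2 ℕ.* (suc n ℕ.* n !)  ≡⟨ x∙yz≈y∙xz ℕ.*-commutativeSemigroup 2 (suc n) (n !) ⟩
  suc n ℕ.* (2 ℕ.* n !)  ≤⟨ ℕ.*-monoʳ-≤ (suc n) (2*n!≤n^n {n} (ℕ.s≤s (ℕ.s≤s ℕ.z≤n))) ⟩
  suc n ℕ.* n ℕ.^ n      ≤⟨ ℕ.*-monoʳ-≤ (suc n) (ℕ.^-monoˡ-≤ n (ℕ.n≤1+n n)) ⟩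
  suc n ℕ.^ suc n        ∎
  where
  open ℕ.≤-Reasoning

term≤sum : ∀ {n} (f : Fin n → ℕ) i → f i ℕ.≤ ℕ∑.sum f
term≤sum f zero    = ℕ.m≤m+n (f zero) _
term≤sum f (suc i) = ℕ.≤-trans (term≤sum (f ∘ suc) i) (ℕ.m≤n+m _ (f zero))

sum≡1⇒single : ∀ {n} (f : Fin n → ℕ) → ℕ∑.sum f ≡ 1 →
               ∃[ u ] f u ≡ 1 × (∀ w → w ≢ u → f w ≡ 0)
sum≡1⇒single {suc n} f ∑f≡1 with f zero in f0
... | 0 with u , fu≡1 , f≡0 ← sum≡1⇒single (f ∘ suc) ∑f≡1 = suc u , fu≡1 , rest
  where
  rest : ∀ w → w ≢ suc u → f w ≡ 0
  rest zero    _    = f0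
  rest (suc w) w≢u  = f≡0 w (w≢u ∘ ≡.cong suc)
... | 1 = zero , f0 , rest
  where
  rest : ∀ w → w ≢ zero → f w ≡ 0
  rest zero    0≢0 = contradiction ≡.refl 0≢0
  rest (suc w) _   = ℕ.n≤0⇒n≡0
    (ℕ.≤-trans (term≤sum (f ∘ suc) w) (ℕ.≤-reflexive (ℕ.suc-injective ∑f≡1)))

-- Multiplicity `m` concentrated on copy `i`. The indices are natural numbers since `k v` equals `r`
-- only propositionally; a function on ℕ serves both `Fin (k v)` and `Fin r` without transport.
δ : ℕ → ℕ → ℕ → ℕ
δ m i j = if does (j ℕ.≟ i) then m else 0

δ-same : ∀ m i → δ m i i ≡ m
δ-same m i = ≡.cong (if_then m else 0) (dec-true (i ℕ.≟ i) ≡.refl)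

δ-other : ∀ m {i j} → j ≢ i → δ m i j ≡ 0
δ-other m {i} {j} j≢i = ≡.cong (if_then m else 0) (dec-false (j ℕ.≟ i) j≢i)

δ-≤ : ∀ m i j → δ m i j ℕ.≤ m
δ-≤ m i j with does (j ℕ.≟ i)
... | true  = ℕ.≤-refl
... | false = ℕ.z≤n

∑-δ : ∀ m {n} (i : Fin n) → ℕ∑.sum (λ (j : Fin n) → δ m (toℕ i) (toℕ j)) ≡ m
∑-δ m i = ≡.trans (sum-single i _ λ j j≢i → δ-other m (j≢i ∘ toℕ-injective)) (δ-same m (toℕ i))
  where open FiniteSum ℕ.+-0-commutativeMonoid

∑-one : ∀ n → ℕ∑.sum (λ (_ : Fin n) → 1) ≡ n
∑-one zero    = ≡.refl
∑-one (suc n) = ≡.cong suc (∑-one n)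

All-spread : ∀ {a p} {A : Set a} {Q : A → Set p} {n} (k : Fin n → ℕ) (f : ∀ u → Fin (k u) → A) →
             (∀ u i → Q (f u i)) → VecAll.All Q (spread k f)
All-spread {n = zero}  k f Qf = VecAll.[]
All-spread {n = suc n} k f Qf =
  VecAll.++⁺ (VecAll.tabulate⁺ (Qf zero)) (All-spread (k ∘ suc) (f ∘ suc) (Qf ∘ suc))

-- Constructive order and arithmetic of the reals.

module OrderedField {c ℓ₁ ℓ₂} (ℝ : RealNumbers c ℓ₁ ℓ₂) where
  open RealNumbers ℝ hiding (zero)
  open CommutativeRing commutativeRing public
    using ( commutativeSemiring; +-commutativeMonoid; *-commutativeMonoid; +-group
          ; +-commutativeSemigroup; *-commutativeSemigroup)
  import Algebra.Apartness.Properties.HeytingCommutativeRing heytingCommutativeRing as HP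
  import Algebra.Properties.Semiring.Mult semiring as Mult
  import Relation.Binary.Reasoning.Setoid setoid as ≈

  private variable
    x y z x′ y′ : Carrier

  -- The substitute for trichotomy. It is what makes the negatively defined `≤` transitive and
  -- compatible with `<`.
  <-cotrans : x < y → ∀ z → x < z ⊎ z < y
  <-cotrans x<y z with #-cotrans (<⇒# x<y) z
  ... | inj₁ x#z = [ inj₁ , (λ z<x → inj₂ (<-trans z<x x<y)) ]′ (#⇒<⊎> x#z)
  ... | inj₂ z#y = [ inj₂ , (λ y<z → inj₁ (<-trans x<y y<z)) ]′ (#⇒<⊎> z#y)

  <⇒≤ : x < y → x ≤ y
  <⇒≤ = <-asym

  ≤-reflexive : x ≈ y → x ≤ y
  ≤-reflexive x≈y = <-irrefl (sym x≈y)

  ≤ᴿ-trans : x ≤ y → y ≤ z → x ≤ z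
  ≤ᴿ-trans {y = y} x≤y y≤z z<x = [ y≤z , x≤y ]′ (<-cotrans z<x y)

  <-≤-trans : x < y → y ≤ z → x < z
  <-≤-trans {z = z} x<y y≤z with <-cotrans x<y z
  ... | inj₁ x<z = x<z
  ... | inj₂ z<y = contradiction z<y y≤z

  ≤-antisym : x ≤ y → y ≤ x → x ≈ y
  ≤-antisym x≤y y≤x = proj₁ (tight _ _) ([ y≤x , x≤y ]′ ∘ #⇒<⊎>)

  ≤-preorder : Preorder c ℓ₁ ℓ₂
  ≤-preorder = record
    { _≲_        = _≤_
    ; isPreorder = record
      { isEquivalence = isEquivalence
      ; reflexive     = ≤-reflexive
      ; trans         = ≤ᴿ-trans
      }
    }

  open import Relation.Binary.Reasoning.Preorder ≤-preorder

  +-cancelˡ-< : ∀ z → z + x < z + y → x < y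
  +-cancelˡ-< {x} {y} z lt =
    <-respˡ-≈ (cancel x) (<-respʳ-≈ (cancel y) (+-monoʳ-< (- z) lt))
    where
    cancel : ∀ x → - z + (z + x) ≈ x
    cancel x = trans (sym (+-assoc _ _ _)) (trans (+-congʳ (-‿inverseˡ z)) (+-identityˡ x))

  +-monoʳ-≤ : ∀ z → x ≤ y → z + x ≤ z + y
  +-monoʳ-≤ z x≤y lt = x≤y (+-cancelˡ-< z lt)

  +-mono-≤ : x ≤ y → x′ ≤ y′ → x + x′ ≤ y + y′
  +-mono-≤ {x} {y} {x′} {y′} x≤y x′≤y′ = begin
    x + x′  ≲⟨ +-monoʳ-≤ x x′≤y′ ⟩
    x + y′  ≈⟨ +-comm x y′ ⟩
    y′ + x  ≲⟨ +-monoʳ-≤ y′ x≤y ⟩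
    y′ + y  ≈⟨ +-comm y′ y ⟩
    y + y′  ∎

  +-nonneg : 0# ≤ x → 0# ≤ y → 0# ≤ x + y
  +-nonneg 0≤x 0≤y = ≤ᴿ-trans (≤-reflexive (sym (+-identityˡ 0#))) (+-mono-≤ 0≤x 0≤y)

  x<y⇒0<y-x : x < y → 0# < y - x
  x<y⇒0<y-x {x} {y} x<y = <-respˡ-≈ (-‿inverseˡ x) (<-respʳ-≈ (+-comm _ _) (+-monoʳ-< (- x) x<y))

  *-monoʳ-< : 0# < z → x < y → z * x < z * y
  *-monoʳ-< {z} {x} {y} 0<z x<y =
    <-respˡ-≈ (+-identityʳ _) (<-respʳ-≈ eq (+-monoʳ-< (z * x) (*-pos 0<z (x<y⇒0<y-x x<y))))
    where
    eq : z * x + z * (y - x) ≈ z * y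
    eq = ≈.begin
      z * x + z * (y - x)  ≈.≈⟨ distribˡ z x (y - x) ⟨
      z * (x + (y - x))    ≈.≈⟨ *-congˡ (+-congˡ (+-comm y (- x))) ⟩
      z * (x + (- x + y))  ≈.≈⟨ *-congˡ (+-assoc x (- x) y) ⟨
      z * (x - x + y)      ≈.≈⟨ *-congˡ (+-congʳ (-‿inverseʳ x)) ⟩
      z * (0# + y)         ≈.≈⟨ *-congˡ (+-identityˡ y) ⟩
      z * y                ≈.∎

  *-cancelˡ-≤ : 0# < z → z * x ≤ z * y → x ≤ y
  *-cancelˡ-≤ 0<z zx≤zy y<x = zx≤zy (*-monoʳ-< 0<z y<x)

  *-cancelˡ-≈ : 0# < z → z * x ≈ z * y → x ≈ y
  *-cancelˡ-≈ 0<z eq = ≤-antisym (*-cancelˡ-≤ 0<z (≤-reflexive eq))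
                                 (*-cancelˡ-≤ 0<z (≤-reflexive (sym eq)))

  -- Apart from 0 means invertible, and an inverse of `x * y` multiplied by `y` inverts `x`.
  xy#0⇒x#0 : x * y # 0# → x # 0#
  xy#0⇒x#0 {x} {y} xy#0 with #⇒invertible xy#0
  ... | i , i*xy≈1 , _ = HP.invertibleˡ⇒# (i * y , (≈.begin
    i * y * (x - 0#)    ≈.≈⟨ *-congˡ (HP.x-0≈x x) ⟩
    i * y * x           ≈.≈⟨ *-assoc i y x ⟩
    i * (y * x)         ≈.≈⟨ *-congˡ (*-comm y x) ⟩
    i * (x * y)         ≈.≈⟨ *-congˡ (HP.x-0≈x (x * y)) ⟨
    i * (x * y - 0#)    ≈.≈⟨ i*xy≈1 ⟩
    1#                  ≈.∎))

  0≤x∧x#0⇒0<x : 0# ≤ x → x # 0# → 0# < x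
  0≤x∧x#0⇒0<x 0≤x x#0 = [ (λ x<0 → contradiction x<0 0≤x) , (λ 0<x → 0<x) ]′ (#⇒<⊎> x#0)

  -- A negative x * y would make x and y apart from 0, hence positive.
  *-nonneg : 0# ≤ x → 0# ≤ y → 0# ≤ x * y
  *-nonneg {x} {y} 0≤x 0≤y xy<0 = <-asym xy<0
    (*-pos (0≤x∧x#0⇒0<x 0≤x (xy#0⇒x#0 (<⇒# xy<0)))
           (0≤x∧x#0⇒0<x 0≤y (xy#0⇒x#0 (<⇒# (<-respˡ-≈ (*-comm x y) xy<0)))))

  x≤y⇒0≤y-x : x ≤ y → 0# ≤ y - x
  x≤y⇒0≤y-x {x} {y} x≤y = begin
    0#       ≈⟨ -‿inverseˡ x ⟨
    - x + x  ≲⟨ +-monoʳ-≤ (- x) x≤y ⟩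
    - x + y  ≈⟨ +-comm _ _ ⟩
    y - x    ∎

  x-y+y≈x : ∀ x y → x - y + y ≈ x
  x-y+y≈x x y = trans (+-assoc x (- y) y) (trans (+-congˡ (-‿inverseˡ y)) (+-identityʳ x))

  x≤y+x : ∀ x → 0# ≤ y → x ≤ y + x
  x≤y+x {y} x 0≤y = begin
    x       ≈⟨ +-identityˡ x ⟨
    0# + x  ≲⟨ +-mono-≤ 0≤y (≤-reflexive refl) ⟩
    y + x   ∎

  *-monoʳ-≤ : 0# ≤ z → x ≤ y → z * x ≤ z * y
  *-monoʳ-≤ {z} {x} {y} 0≤z x≤y = begin
    z * x                ≲⟨ x≤y+x (z * x) (*-nonneg 0≤z (x≤y⇒0≤y-x x≤y)) ⟩
    z * (y - x) + z * x  ≈⟨ distribˡ z (y - x) x ⟨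
    z * (y - x + x)      ≈⟨ *-congˡ (x-y+y≈x y x) ⟩
    z * y                ∎

  *-mono-≤ : 0# ≤ x → 0# ≤ y′ → x ≤ y → x′ ≤ y′ → x * x′ ≤ y * y′
  *-mono-≤ {x} {y′} {y} {x′} 0≤x 0≤y′ x≤y x′≤y′ = begin
    x * x′  ≲⟨ *-monoʳ-≤ 0≤x x′≤y′ ⟩
    x * y′  ≈⟨ *-comm x y′ ⟩
    y′ * x  ≲⟨ *-monoʳ-≤ 0≤y′ x≤y ⟩
    y′ * y  ≈⟨ *-comm y′ y ⟩
    y * y′  ∎

  0≤1 : 0# ≤ 1#
  0≤1 = <⇒≤ 0<1

  ^-nonneg : 0# ≤ x → ∀ n → 0# ≤ x ^ n
  ^-nonneg 0≤x zero    = 0≤1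
  ^-nonneg 0≤x (suc n) = *-nonneg 0≤x (^-nonneg 0≤x n)

  product-nonneg : ∀ {n} (f : Fin n → Carrier) → (∀ i → 0# ≤ f i) → 0# ≤ product f
  product-nonneg {zero}  f 0≤f = 0≤1
  product-nonneg {suc n} f 0≤f = *-nonneg (0≤f zero) (product-nonneg (f ∘ suc) (0≤f ∘ suc))

  1≤product : ∀ {n} (f : Fin n → Carrier) → (∀ i → 1# ≤ f i) → 1# ≤ product f
  1≤product {zero}  f 1≤f = ≤-reflexive refl
  1≤product {suc n} f 1≤f = begin
    1#                      ≲⟨ 1≤product (f ∘ suc) (1≤f ∘ suc) ⟩
    product (f ∘ suc)       ≈⟨ *-identityˡ _ ⟨
    1# * product (f ∘ suc)  ≲⟨ *-mono-≤ 0≤1 (≤ᴿ-trans 0≤1 (1≤product (f ∘ suc) (1≤f ∘ suc)))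
                                 (1≤f zero) (≤-reflexive refl) ⟩
    product f               ∎

  factor≤product : ∀ {n} (f : Fin n → Carrier) → (∀ i → 1# ≤ f i) → ∀ i → f i ≤ product f
  factor≤product f 1≤f zero = begin
    f zero       ≈⟨ *-identityʳ _ ⟨
    f zero * 1#  ≲⟨ *-monoʳ-≤ (≤ᴿ-trans 0≤1 (1≤f zero)) (1≤product (f ∘ suc) (1≤f ∘ suc)) ⟩
    product f    ∎
  factor≤product f 1≤f (suc i) = begin
    f (suc i)                   ≈⟨ *-identityˡ _ ⟨
    1# * f (suc i)              ≲⟨ *-mono-≤ 0≤1 (≤ᴿ-trans 0≤1 (1≤product (f ∘ suc) (1≤f ∘ suc)))
                                     (1≤f zero) (factor≤product (f ∘ suc) (1≤f ∘ suc) i) ⟩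
    product f                   ∎

  0<ι : ∀ d → .{{ℕ.NonZero d}} → 0# < ι d
  0<ι (suc d) = 0<ι[1+n] d

  0≤ι : ∀ n → 0# ≤ ι n
  0≤ι zero    = ≤-reflexive refl
  0≤ι (suc n) = <⇒≤ (0<ι[1+n] n)

  ι-homo-* : ∀ m n → ι (m ℕ.* n) ≈ ι m * ι n
  ι-homo-* = Mult.×1-homo-*

  ι-homo-+ : ∀ m n → ι (m ℕ.+ n) ≈ ι m + ι n
  ι-homo-+ = Mult.×-homo-+ 1#

  ι-homo-^ : ∀ m n → ι (m ℕ.^ n) ≈ ι m ^ n
  ι-homo-^ m zero    = +-identityʳ 1#
  ι-homo-^ m (suc n) = trans (ι-homo-* m (m ℕ.^ n)) (*-congˡ (ι-homo-^ m n))

  ι-homo-sum : ∀ {n} (f : Fin n → ℕ) → ι (ℕ∑.sum f) ≈ sum (ι ∘ f)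
  ι-homo-sum {zero}  f = refl
  ι-homo-sum {suc n} f = trans (ι-homo-+ (f zero) _) (+-congˡ (ι-homo-sum (f ∘ suc)))

  ι-mono-≤ : ∀ {m n} → m ℕ.≤ n → ι m ≤ ι n
  ι-mono-≤ {n = n} ℕ.z≤n = 0≤ι n
  ι-mono-≤ (ℕ.s≤s m≤n)   = +-monoʳ-≤ 1# (ι-mono-≤ m≤n)

  -- Quotients are known only through `ι*/`, so statements about them are multiplied by the
  -- denominator, proved there, and cancelled.
  ι-*-cancelˡ-≈ : ∀ d .{{_ : ℕ.NonZero d}} → ι d * x ≈ ι d * y → x ≈ y
  ι-*-cancelˡ-≈ d = *-cancelˡ-≈ (0<ι d)

  ι-*-cancelˡ-≤ : ∀ d .{{_ : ℕ.NonZero d}} → ι d * x ≤ ι d * y → x ≤ y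
  ι-*-cancelˡ-≤ d = *-cancelˡ-≤ (0<ι d)

  0≤ιd*x⇒0≤x : ∀ d .{{_ : ℕ.NonZero d}} → 0# ≤ ι d * x → 0# ≤ x
  0≤ιd*x⇒0≤x d 0≤dx = ι-*-cancelˡ-≤ d (≤ᴿ-trans (≤-reflexive (zeroʳ (ι d))) 0≤dx)

  /-nonneg : 0# ≤ x → ∀ d .{{_ : ℕ.NonZero d}} → 0# ≤ x / d
  /-nonneg {x} 0≤x d = 0≤ιd*x⇒0≤x d (≤ᴿ-trans 0≤x (≤-reflexive (sym (ι*/ x d))))

  /-pos : 0# < x → ∀ d .{{_ : ℕ.NonZero d}} → 0# < x / d
  /-pos {x} 0<x d = 0≤x∧x#0⇒0<x (/-nonneg (<⇒≤ 0<x) d) (xy#0⇒x#0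
    (#-sym (<⇒# (<-respʳ-≈ (trans (sym (ι*/ x d)) (*-comm (ι d) (x / d))) 0<x))))

  /-unique : ∀ d .{{_ : ℕ.NonZero d}} → ι d * y ≈ x → y ≈ x / d
  /-unique {x = x} d eq = ι-*-cancelˡ-≈ d (trans eq (sym (ι*/ x d)))

  product-pos : ∀ {n} (f : Fin n → Carrier) → (∀ i → 0# < f i) → 0# < product f
  product-pos {zero}  f 0<f = 0<1
  product-pos {suc n} f 0<f = *-pos (0<f zero) (product-pos (f ∘ suc) (0<f ∘ suc))

  sum-constant : ∀ n x → sum (λ (_ : Fin n) → x) ≈ ι n * x
  sum-constant n x = ≈.begin
    sum (λ (_ : Fin n) → x)  ≈.≈⟨ Sum.sum-replicate +-commutativeMonoid n ⟩
    n · x                    ≈.≈⟨ Mult.×-congʳ n (*-identityˡ x) ⟨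
    n · (1# * x)             ≈.≈⟨ Mult.×-assoc-* n 1# x ⟨
    ι n * x                  ≈.∎

-- Weights of edge lists, and lower bounds on λ(P) from one edge.

module Weights {c ℓ₁ ℓ₂} (ℝ : RealNumbers c ℓ₁ ℓ₂) where
  open RealNumbers ℝ hiding (zero)
  open OrderedField ℝ
  open Lagrangian ℝ
  open import Algebra.Properties.CommutativeSemiring.Exp commutativeSemiring hiding (_^_)
  open import Algebra.Properties.Semiring.Sum semiring using (*-distribˡ-sum; sum-cong-≋)
  module ∏ = Sum *-commutativeMonoid
  import Relation.Binary.Reasoning.Setoid setoid as ≈
  open import Relation.Binary.Reasoning.Preorder ≤-preorder

  private variable
    a : Level
    A B : Set a
    x y : Carrier

  infixr 8 _^/!_

  -- The divided power, which is the factor of a single vertex in an edge weight.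
  _^/!_ : Carrier → ℕ → Carrier
  x ^/! m = _/_ (x ^ m) (m !) {{ m ℕ.!≢0 }}

  ι*^/! : ∀ x m → ι (m !) * x ^/! m ≈ x ^ m
  ι*^/! x m = ι*/ (x ^ m) (m !) {{ m ℕ.!≢0 }}

  ^/!-nonneg : 0# ≤ x → ∀ m → 0# ≤ x ^/! m
  ^/!-nonneg 0≤x m = /-nonneg (^-nonneg 0≤x m) (m !) {{ m ℕ.!≢0 }}

  x^/!0≈1 : ∀ x → x ^/! 0 ≈ 1#
  x^/!0≈1 x = ι-*-cancelˡ-≈ 1 (trans (ι*^/! x 0)
    (sym (trans (*-congʳ (+-identityʳ 1#)) (*-identityˡ 1#))))

  x^/!1≈x : ∀ x → x ^/! 1 ≈ x
  x^/!1≈x x = ι-*-cancelˡ-≈ 1 (trans (ι*^/! x 1)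
    (trans (*-comm x 1#) (*-congʳ (sym (+-identityʳ 1#)))))

  total : (A → Carrier) → List A → Carrier
  total f xs = List.foldr _+_ 0# (List.map f xs)

  total-nonneg : ∀ {f : A → Carrier} → (∀ x → 0# ≤ f x) → ∀ xs → 0# ≤ total f xs
  total-nonneg 0≤f []       = ≤-reflexive refl
  total-nonneg 0≤f (x ∷ xs) = +-nonneg (0≤f x) (total-nonneg 0≤f xs)

  total-++ : ∀ (f : A → Carrier) xs ys → total f (xs ++ ys) ≈ total f xs + total f ys
  total-++ f []       ys = sym (+-identityˡ _)
  total-++ f (x ∷ xs) ys = trans (+-congˡ (total-++ f xs ys)) (sym (+-assoc _ _ _))

  total-tabulate : ∀ (f : A → Carrier) {n} (g : Fin n → A) →
                   total f (List.tabulate g) ≈ sum (f ∘ g)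
  total-tabulate f {zero}  g = refl
  total-tabulate f {suc n} g = +-congˡ (total-tabulate f (g ∘ suc))

  total-concatMap : ∀ (f : B → Carrier) (g : A → Carrier) (h : A → List B) xs →
                    (∀ {x} → x ∈ xs → total f (h x) ≈ g x) →
                    total f (concatMap h xs) ≈ total g xs
  total-concatMap f g h []       eq = refl
  total-concatMap f g h (x ∷ xs) eq = trans (total-++ f (h x) (concatMap h xs))
    (+-cong (eq (here ≡.refl)) (total-concatMap f g h xs (eq ∘ there)))

  -- Cut the head `x` of `xs` out of `ys`. As `x` does not recur in `xs`, the tail is still
  -- contained in what remains of `ys`.
  total-mono-⊆ : ∀ {f : A → Carrier} → (∀ x → 0# ≤ f x) → ∀ {xs ys} →
                 Unique xs → (∀ {x} → x ∈ xs → x ∈ ys) → total f xs ≤ total f ys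
  total-mono-⊆ 0≤f {[]} {ys} _ _ = total-nonneg 0≤f ys
  total-mono-⊆ {f = f} 0≤f {x ∷ xs} (x∉xs ∷ xs!) xs⊆ys
    with as , bs , ≡.refl ← ∈-∃++ (xs⊆ys (here ≡.refl)) = begin
    f x + total f xs                  ≲⟨ +-monoʳ-≤ (f x) (total-mono-⊆ 0≤f xs! xs⊆as++bs) ⟩
    f x + total f (as ++ bs)          ≈⟨ +-congˡ (total-++ f as bs) ⟩
    f x + (total f as + total f bs)   ≈⟨ x∙yz≈y∙xz +-commutativeSemigroup _ _ _ ⟩
    total f as + (f x + total f bs)   ≈⟨ total-++ f as (x ∷ bs) ⟨
    total f (as ++ x ∷ bs)            ∎
    where
    xs⊆as++bs : ∀ {z} → z ∈ xs → z ∈ as ++ bs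
    xs⊆as++bs z∈xs with ∈-++⁻ as (xs⊆ys (there z∈xs))
    ... | inj₁ z∈as              = ∈-++⁺ˡ z∈as
    ... | inj₂ (there z∈bs)      = ∈-++⁺ʳ as z∈bs
    ... | inj₂ (here ≡.refl)     = contradiction ≡.refl (All.lookup x∉xs z∈xs)

  module _ {r} (P : Pattern r) where
    open Pattern P

    ∈-edges : ∀ {e} → Edge e → e ∈ edges
    ∈-edges {e} E = ∈-filter⁺ edge? (∈-multisets r e (uniform E)) E

    edgeWeight-nonneg : ∀ {w} → (∀ u → 0# ≤ w u) → ∀ e → 0# ≤ edgeWeight P w e
    edgeWeight-nonneg 0≤w e = product-nonneg _ λ u → ^/!-nonneg (0≤w u) (lookup e u)

    -- The source of all lower bounds: exhibit some distinct edges and discard the nonnegative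
    -- weight of the others.
    total≤weight : ∀ {w} → (∀ u → 0# ≤ w u) → ∀ {es} → Unique es → All Edge es →
                   total (edgeWeight P w) es ≤ weight P w
    total≤weight 0≤w es! Es = total-mono-⊆ (edgeWeight-nonneg 0≤w) es! (∈-edges ∘ All.lookup Es)

    edgeWeight≤weight : ∀ {w} → (∀ u → 0# ≤ w u) → ∀ {e} → Edge e →
                        edgeWeight P w e ≤ weight P w
    edgeWeight≤weight {w} 0≤w {e} E = begin
      edgeWeight P w e       ≈⟨ +-identityʳ _ ⟨
      edgeWeight P w e + 0#  ≲⟨ total≤weight 0≤w ([] ∷ []) (E ∷ []) ⟩
      weight P w             ∎

    module _ .{{_ : ℕ.NonZero r}} {e} (E : Edge e) where
      proportional : Vertex → Carrier
      proportional u = ι (lookup e u) / r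

      proportional-isWeighting : IsWeighting P proportional
      proportional-isWeighting = (λ u → /-nonneg (0≤ι (lookup e u)) r) , ι-*-cancelˡ-≈ r (≈.begin
        ι r * sum proportional              ≈.≈⟨ *-distribˡ-sum (ι r) proportional ⟩
        sum (λ u → ι r * proportional u)    ≈.≈⟨ sum-cong-≋ (λ u → ι*/ (ι (lookup e u)) r) ⟩
        sum (λ u → ι (lookup e u))          ≈.≈⟨ ι-homo-sum (lookup e) ⟨
        ι (size e)                          ≈.≡⟨ ≡.cong ι (uniform E) ⟩
        ι r                                 ≈.≈⟨ *-identityʳ (ι r) ⟨
        ι r * 1#                            ≈.∎)

      -- The denominator `r` occurs m_e(u) times in the factor of each u, hence `size e`, that is
      -- `r`, times in total.
      ι[r^r]*edgeWeight : ι (r ℕ.^ r) * edgeWeight P proportional e ≈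
                          product λ u → ι (lookup e u) ^/! lookup e u
      ι[r^r]*edgeWeight = ≈.begin
        ι (r ℕ.^ r) * edgeWeight P proportional e
          ≈.≈⟨ *-congʳ (ι-homo-^ r r) ⟩
        ι r ^ r * edgeWeight P proportional e
          ≈.≡⟨ ≡.cong (λ m → ι r ^ m * edgeWeight P proportional e) (uniform E) ⟨
        ι r ^ size e * edgeWeight P proportional e
          ≈.≈⟨ *-congʳ (^-sum (ι r) (lookup e)) ⟩
        product (λ u → ι r ^ lookup e u) * edgeWeight P proportional e
          ≈.≈⟨ ∏.∑-distrib-+ (λ u → ι r ^ lookup e u) (λ u → proportional u ^/! lookup e u) ⟨
        product (λ u → ι r ^ lookup e u * proportional u ^/! lookup e u)
          ≈.≈⟨ ∏.sum-cong-≋ (λ u → factor (lookup e u)) ⟩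
        product (λ u → ι (lookup e u) ^/! lookup e u)
          ≈.∎
        where
        ^-sum : ∀ x {n} (f : Fin n → ℕ) → x ^ ℕ∑.sum f ≈ product λ u → x ^ f u
        ^-sum x {zero}  f = refl
        ^-sum x {suc n} f = trans (^-homo-* x (f zero) _) (*-congˡ (^-sum x (f ∘ suc)))

        factor : ∀ m → ι r ^ m * (ι m / r) ^/! m ≈ ι m ^/! m
        factor m = /-unique (m !) {{ m ℕ.!≢0 }} (≈.begin
          ι (m !) * (ι r ^ m * (ι m / r) ^/! m)  ≈.≈⟨ x∙yz≈y∙xz *-commutativeSemigroup _ _ _ ⟩
          ι r ^ m * (ι (m !) * (ι m / r) ^/! m)  ≈.≈⟨ *-congˡ (ι*^/! (ι m / r) m) ⟩
          ι r ^ m * (ι m / r) ^ m                ≈.≈⟨ ^-distrib-* (ι r) (ι m / r) m ⟨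
          (ι r * (ι m / r)) ^ m                  ≈.≈⟨ ^-congˡ m (ι*/ (ι m) r) ⟩
          ι m ^ m                                ≈.∎)

      ι^/!≤ι[r^r]*λ : ∀ {l} → IsLagrangian P l → ∀ u →
                      ι (lookup e u) ^/! lookup e u ≤ ι (r ℕ.^ r) * l
      ι^/!≤ι[r^r]*λ {l} (_ , weight≤l) u = begin
        ι (lookup e u) ^/! lookup e u                      ≲⟨ factor≤product _ (1≤ι^/! ∘ lookup e) u ⟩
        product (λ u → ι (lookup e u) ^/! lookup e u)      ≈⟨ ι[r^r]*edgeWeight ⟨
        ι (r ℕ.^ r) * edgeWeight P proportional e          ≲⟨ *-monoʳ-≤ (0≤ι (r ℕ.^ r))
          (≤ᴿ-trans (edgeWeight≤weight (proj₁ proportional-isWeighting) E)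
                    (weight≤l proportional proportional-isWeighting)) ⟩
        ι (r ℕ.^ r) * l                                    ∎
        where
        1≤ι^/! : ∀ m → 1# ≤ ι m ^/! m
        1≤ι^/! m = ι-*-cancelˡ-≤ (m !) {{ m ℕ.!≢0 }} (begin
          ι (m !) * 1#           ≈⟨ *-identityʳ _ ⟩
          ι (m !)                ≲⟨ ι-mono-≤ (n!≤n^n m) ⟩
          ι (m ℕ.^ m)            ≈⟨ ι-homo-^ m m ⟩
          ι m ^ m                ≈⟨ ι*^/! (ι m) m ⟨
          ι (m !) * ι m ^/! m    ∎)

      2≤ι[r^r]*λ : ∀ {l} → IsLagrangian P l → ∀ {u} → 2 ℕ.≤ lookup e u → ι 2 ≤ ι (r ℕ.^ r) * l
      2≤ι[r^r]*λ lagr {u} 2≤m = ≤ᴿ-trans (ι-*-cancelˡ-≤ (m !) {{ m ℕ.!≢0 }} (begin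
          ι (m !) * ι 2          ≈⟨ *-comm _ _ ⟩
          ι 2 * ι (m !)          ≈⟨ ι-homo-* 2 (m !) ⟨
          ι (2 ℕ.* m !)          ≲⟨ ι-mono-≤ (2*n!≤n^n 2≤m) ⟩
          ι (m ℕ.^ m)            ≈⟨ ι-homo-^ m m ⟩
          ι m ^ m                ≈⟨ ι*^/! (ι m) m ⟨
          ι (m !) * ι m ^/! m    ∎)) (ι^/!≤ι[r^r]*λ lagr u)
        where m = lookup e u

      -- All of e lies on `u`, whose factor r^r / r! already cancels the denominator r^r.
      r!λ≥1 : ∀ {l} → IsLagrangian P l → ∀ {u} → lookup e u ≡ r → 1# ≤ ι (r !) * l
      r!λ≥1 {l} lagr {u} m≡r = ι-*-cancelˡ-≤ (r ℕ.^ r) {{ m^n≢0 r r }} (begin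
        ι (r ℕ.^ r) * 1#                           ≈⟨ *-identityʳ _ ⟩
        ι (r ℕ.^ r)                                ≈⟨ ι-homo-^ r r ⟩
        ι r ^ r                                    ≈⟨ ι*^/! (ι r) r ⟨
        ι (r !) * ι r ^/! r                        ≡⟨ ≡.cong (λ m → ι (r !) * ι m ^/! m) m≡r ⟨
        ι (r !) * ι (lookup e u) ^/! lookup e u    ≲⟨ *-monoʳ-≤ (0≤ι (r !)) (ι^/!≤ι[r^r]*λ lagr u) ⟩
        ι (r !) * (ι (r ℕ.^ r) * l)                ≈⟨ x∙yz≈y∙xz *-commutativeSemigroup _ _ _ ⟩
        ι (r ℕ.^ r) * (ι (r !) * l)                ∎)

-- Multisets on the blow-up described by their values on the copies of v.

module Clones {r} (P : Pattern r) (v : Pattern.Vertex P) where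
  open Pattern P
  open FranklRödl P v hiding (FR)

  k-on : k v ≡ r
  k-on = ≡.cong (if_then r else 1) (dec-true (v ≟ v) ≡.refl)

  k-off : ∀ {u} → u ≢ v → k u ≡ 1
  k-off {u} u≢v = ≡.cong (if_then r else 1) (dec-false (u ≟ v) u≢v)

  -- The vector with entry α i at (v , 1 + i) and β u at (u , 1) for u ≢ v.
  clonewise : ∀ {a} {A : Set a} → (ℕ → A) → (Vertex → A) → Vec A P[k].order
  clonewise α β = spread k λ u i → if does (u ≟ v) then α (toℕ i) else β u

  module _ {a} {A : Set a} where
    lookup-clonewise : ∀ (α : ℕ → A) β u i → lookup (clonewise α β) (copy k u i) ≡
                       (if does (u ≟ v) then α (toℕ i) else β u)
    lookup-clonewise α β = lookup-spread k _

    lookup-clonewise-on : ∀ (α : ℕ → A) β i → lookup (clonewise α β) (copy k v i) ≡ α (toℕ i)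
    lookup-clonewise-on α β i = ≡.trans (lookup-clonewise α β v i)
      (≡.cong (if_then α (toℕ i) else β v) (dec-true (v ≟ v) ≡.refl))

    -- All edges over the same edge of P agree away from v, so the copies of v are where they are
    -- told apart.
    clonewise-injective : ∀ (α α′ : ℕ → A) {β β′} → clonewise α β ≡ clonewise α′ β′ →
                          ∀ (j : Fin r) → α (toℕ j) ≡ α′ (toℕ j)
    clonewise-injective α α′ {β} {β′} eq j = begin
      α (toℕ j)                               ≡⟨ ≡.cong α (toℕ-cast (≡.sym k-on) j) ⟨
      α (toℕ j′)                              ≡⟨ lookup-clonewise-on α β j′ ⟨
      lookup (clonewise α β) (copy k v j′)    ≡⟨ ≡.cong (λ e → lookup e (copy k v j′)) eq ⟩
      lookup (clonewise α′ β′) (copy k v j′)  ≡⟨ lookup-clonewise-on α′ β′ j′ ⟩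
      α′ (toℕ j′)                             ≡⟨ ≡.cong α′ (toℕ-cast (≡.sym k-on) j) ⟩
      α′ (toℕ j)                              ∎
      where
      open ≡.≡-Reasoning
      j′ = cast (≡.sym k-on) j

  -- Needed in three monoids: multiplicities in ℕ, vertex weights under `+`, and the factors of an
  -- edge weight under `*`.
  module CloneSum {c ℓ} (M : CommutativeMonoid c ℓ) where
    open CommutativeMonoid M
    open Sum M using (sum; sum-cong-≋)
    open FiniteSum M

    sum-toℕ : ∀ {m n} (f : Fin m → Carrier) (α : ℕ → Carrier) → m ≡ n →
              (∀ i → f i ≈ α (toℕ i)) → sum f ≈ sum (λ (i : Fin n) → α (toℕ i))
    sum-toℕ f α ≡.refl eq = sum-cong-≋ eq

    sum-copies-on : ∀ (f : Fin (k v) → Carrier) (α : ℕ → Carrier) {β} →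
                    (∀ i → f i ≈ (if does (v ≟ v) then α (toℕ i) else β)) →
                    sum f ≈ sum (λ (i : Fin r) → α (toℕ i))
    sum-copies-on f α {β} eq = sum-toℕ f α k-on λ i → trans (eq i)
      (reflexive (≡.cong (if_then α (toℕ i) else β) (dec-true (v ≟ v) ≡.refl)))

    sum-copies-off : ∀ {u} → u ≢ v → ∀ (f : Fin (k u) → Carrier) (α : ℕ → Carrier) {β} →
                     (∀ i → f i ≈ (if does (u ≟ v) then α (toℕ i) else β)) → sum f ≈ β
    sum-copies-off {u} u≢v f α {β} eq = trans
      (sum-toℕ f (λ _ → β) (k-off u≢v) λ i → trans (eq i)
        (reflexive (≡.cong (if_then α (toℕ i) else β) (dec-false (u ≟ v) u≢v))))
      (identityʳ β)

    sum-clonewise : ∀ (f : Fin P[k].order → Carrier) (α : ℕ → Carrier) (β : Vertex → Carrier) →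
                    (∀ u i → f (copy k u i) ≈ (if does (u ≟ v) then α (toℕ i) else β u)) →
                    sum f ≈ sum (λ (i : Fin r) → α (toℕ i)) ∙
                            sum (λ u → if does (u ≟ v) then ε else β u)
    sum-clonewise f α β eq = trans (sum-copy k f) (sym (sum-adjust v _ _ _ off on))
      where
      off : ∀ u → u ≢ v → (if does (u ≟ v) then ε else β u) ≈ sum (f ∘ copy k u)
      off u u≢v = trans (reflexive (≡.cong (if_then ε else β u) (dec-false (u ≟ v) u≢v)))
        (sym (sum-copies-off u≢v (f ∘ copy k u) α (eq u)))

      on : sum (λ (i : Fin r) → α (toℕ i)) ∙ (if does (v ≟ v) then ε else β v) ≈
           sum (f ∘ copy k v)
      on = trans (∙-congˡ (reflexive (≡.cong (if_then ε else β v) (dec-true (v ≟ v) ≡.refl))))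
        (trans (identityʳ _) (sym (sum-copies-on (f ∘ copy k v) α (eq v))))

  project-clonewise : ∀ (a : ℕ → ℕ) (b : Multiset order) →
                      ℕ∑.sum (λ (i : Fin r) → a (toℕ i)) ≡ lookup b v →
                      project k (clonewise a (lookup b)) ≡ b
  project-clonewise a b eq = ≡.trans (tabulate-cong pointwise) (tabulate∘lookup b)
    where
    open CloneSum ℕ.+-0-commutativeMonoid

    pointwise : ∀ u → ℕ∑.sum (λ i → lookup (clonewise a (lookup b)) (copy k u i)) ≡ lookup b u
    pointwise u = by-cases (u ≟ v)
      where
      by-cases : Dec (u ≡ v) → _
      by-cases (yes ≡.refl) = ≡.trans (sum-copies-on _ a (lookup-clonewise a (lookup b) v)) eq
      by-cases (no u≢v)     = sum-copies-off u≢v _ a (lookup-clonewise a (lookup b) u)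

  -- Copies count from 0, so `1 ≤ j` singles out (v,2), ..., (v,r), where E(P') caps the
  -- multiplicity; index 0 is the uncapped copy (v,1).
  FR-edge : ∀ (a : ℕ → ℕ) {b} → Edge b → ℕ∑.sum (λ (i : Fin r) → a (toℕ i)) ≡ lookup b v →
            (∀ j → 1 ℕ.≤ j → a j ℕ.≤ 1) → Pattern.Edge (FR P v) (clonewise a (lookup b))
  FR-edge a {b} E ∑a≡bv a≤1 = inj₁
    ( ≡.subst Edge (≡.sym (project-clonewise a b ∑a≡bv)) E
    , λ i 1≤i → ℕ.≤-trans (ℕ.≤-reflexive (lookup-clonewise-on a (lookup b) i)) (a≤1 (toℕ i) 1≤i)
    )

  -- For multiplicity 0 all `r` choices of a copy give the same multiset, which must be listed once
  -- for the list to be duplicate-free.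
  clones′ : ℕ → Multiset order → List (Multiset P[k].order)
  clones′ zero      e = clonewise (λ _ → 0) (lookup e) ∷ []
  clones′ m@(suc _) e = List.tabulate λ (i : Fin r) → clonewise (δ m (toℕ i)) (lookup e)

  -- The multisets over e in which all occurrences of v become the same copy.
  clones : Multiset order → List (Multiset P[k].order)
  clones e = clones′ (lookup e v) e

  ∈-clones′ : ∀ m e {e′} → e′ ∈ clones′ m e →
              ∃[ a ] e′ ≡ clonewise a (lookup e) ×
                     ℕ∑.sum (λ (i : Fin r) → a (toℕ i)) ≡ m × (∀ j → a j ℕ.≤ m)
  ∈-clones′ zero e (here ≡.refl) = (λ _ → 0) , ≡.refl , ℕ∑.sum-replicate-zero r , λ _ → ℕ.z≤n
  ∈-clones′ m@(suc _) e e′∈ with i , ≡.refl ← ∈-tabulate⁻ e′∈ =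
    δ m (toℕ i) , ≡.refl , ∑-δ m i , δ-≤ m (toℕ i)

  -- A clone determines the edge it came from, so clones of different edges never coincide.
  ∈-clones⇒project : ∀ e {e′} → e′ ∈ clones e → project k e′ ≡ e
  ∈-clones⇒project e e′∈ with a , ≡.refl , ∑a≡m , _ ← ∈-clones′ (lookup e v) e e′∈ =
    project-clonewise a e ∑a≡m

  clones′-unique : ∀ m e → Unique (clones′ m e)
  clones′-unique zero      e = [] ∷ []
  clones′-unique m@(suc _) e = tabulate⁺ injective
    where
    injective : ∀ {i j} →
                clonewise (δ m (toℕ i)) (lookup e) ≡ clonewise (δ m (toℕ j)) (lookup e) → i ≡ j
    injective {i} {j} eq with i ≟ j
    ... | yes i≡j = i≡j
    ... | no  i≢j with () ← ≡.trans (≡.sym (δ-same m (toℕ i)))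
            (≡.trans (clonewise-injective (δ m (toℕ i)) (δ m (toℕ j)) eq i)
                     (δ-other m (i≢j ∘ toℕ-injective)))

  module _ (2≤r : 2 ℕ.≤ r) (v≤1 : ∀ {e} → Edge e → lookup e v ℕ.≤ 1) where
    cloneEdges : List (Multiset P[k].order)
    cloneEdges = newEdge ∷ concatMap clones edges

    cloneEdge⇒clone : ∀ {e′} → e′ ∈ concatMap clones edges → ∃[ e ] Edge e × e′ ∈ clones e
    cloneEdge⇒clone e′∈ with e , e∈edges , e′∈clones ← find (∈-concatMap⁻ clones {xs = edges} e′∈) =
      e , proj₂ (∈-filter⁻ edge? {xs = multisets order r} e∈edges) , e′∈clones

    cloneEdges-edge : All (Pattern.Edge (FR P v)) cloneEdges
    cloneEdges-edge = inj₂ ≡.refl ∷ All.tabulate edge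
      where
      edge : ∀ {e′} → e′ ∈ concatMap clones edges → Pattern.Edge (FR P v) e′
      edge e′∈ with e , E , e′∈clones ← cloneEdge⇒clone e′∈
               with a , ≡.refl , ∑a≡m , a≤m ← ∈-clones′ (lookup e v) e e′∈clones =
        FR-edge a E ∑a≡m λ j _ → ℕ.≤-trans (a≤m j) (v≤1 E)

    cloneEdges-unique : Unique cloneEdges
    cloneEdges-unique = All.tabulate newEdge≢ ∷ concat⁺
      (All.map⁺ (All.universal (λ e → clones′-unique (lookup e v) e) edges))
      (AllPairs.map⁺ (AllPairs.map disjoint (filter⁺ edge? (multisets-unique order r))))
      where
      disjoint : ∀ {e₁ e₂} → e₁ ≢ e₂ → Disjoint (clones e₁) (clones e₂)
      disjoint e₁≢e₂ (∈₁ , ∈₂) =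
        e₁≢e₂ (≡.trans (≡.sym (∈-clones⇒project _ ∈₁)) (∈-clones⇒project _ ∈₂))

      -- The new edge has total multiplicity `r ≥ 2` on the copies of v, a clone at most 1. By
      -- definition `newEdge` is `clonewise (λ _ → 1) (λ _ → 0)`, so `clonewise-injective` applies.
      newEdge≢ : ∀ {e′} → e′ ∈ concatMap clones edges → newEdge ≢ e′
      newEdge≢ e′∈ eq with e , E , e′∈clones ← cloneEdge⇒clone e′∈
               with a , ≡.refl , ∑a≡m , _ ← ∈-clones′ (lookup e v) e e′∈clones =
        ℕ.<⇒≱ 2≤r (begin
          r                                      ≡⟨ ∑-one r ⟨
          ℕ∑.sum (λ (_ : Fin r) → 1)             ≡⟨ ℕ∑.sum-cong-≗ (clonewise-injective (λ _ → 1) a eq) ⟩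
          ℕ∑.sum (λ (i : Fin r) → a (toℕ i))     ≡⟨ ∑a≡m ⟩
          lookup e v                             ≤⟨ v≤1 E ⟩
          1                                      ∎)
        where open ℕ.≤-Reasoning

-- Spreading the weight of v over its copies, and the edge with multiplicity at least 2.

module FRWeights {c ℓ₁ ℓ₂} (ℝ : RealNumbers c ℓ₁ ℓ₂)
                 {r} (P : Pattern r) (v : Pattern.Vertex P) where
  open RealNumbers ℝ hiding (zero)
  open OrderedField ℝ
  open Lagrangian ℝ
  open Weights ℝ
  open Pattern P
  open FranklRödl P v using (k; newEdge)
  open Clones P v
  open FiniteSum *-commutativeMonoid using ()
    renaming (sum-single to product-single; sum-pull to product-pull)
  open FiniteSum +-commutativeMonoid using (sum-pull)
  module +∑ = Sum +-commutativeMonoid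
  module +Clones = CloneSum +-commutativeMonoid
  module *Clones = CloneSum *-commutativeMonoid
  import Relation.Binary.Reasoning.Setoid setoid as ≈
  open import Relation.Binary.Reasoning.Preorder ≤-preorder

  -- The part of an edge weight that an edge shares with all its clones.
  others : (Vertex → Carrier) → Multiset order → Carrier
  others y b = product λ u → if does (u ≟ v) then 1# else y u ^/! lookup b u

  edgeWeight-pull : ∀ y b → y v ^/! lookup b v * others y b ≈ edgeWeight P y b
  edgeWeight-pull y b = product-pull v λ u → y u ^/! lookup b u

  module _ (x : ℕ → Carrier) (y : Vertex → Carrier) where
    w : Fin (Pattern.order (FR P v)) → Carrier
    w = lookup (clonewise x y)

    w-nonneg : (∀ j → 0# ≤ x j) → (∀ u → 0# ≤ y u) → ∀ i → 0# ≤ w i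
    w-nonneg 0≤x 0≤y = VecAll.lookup⁺
      (All-spread {Q = 0# ≤_} k _ λ u i → nonneg (does (u ≟ v)) (toℕ i) u)
      where
      nonneg : ∀ d j u → 0# ≤ (if d then x j else y u)
      nonneg true  j u = 0≤x j
      nonneg false j u = 0≤y u

    sum-w : sum w ≈ sum (λ (j : Fin r) → x (toℕ j)) + sum (λ u → if does (u ≟ v) then 0# else y u)
    sum-w = +Clones.sum-clonewise w x y λ u i → reflexive (lookup-clonewise x y u i)

    edgeWeight-clonewise : ∀ a b → edgeWeight (FR P v) w (clonewise a b) ≈
      product (λ (j : Fin r) → x (toℕ j) ^/! a (toℕ j)) *
      product (λ u → if does (u ≟ v) then 1# else y u ^/! b u)
    edgeWeight-clonewise a b =
      *Clones.sum-clonewise _ (λ j → x j ^/! a j) (λ u → y u ^/! b u) λ u i →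
      reflexive (≡.trans (≡.cong₂ _^/!_ (lookup-clonewise x y u i) (lookup-clonewise a b u i))
                         (if-zip (does (u ≟ v))))
      where
      if-zip : ∀ d {s t m n} → (if d then s else t) ^/! (if d then m else n) ≡
                               (if d then s ^/! m else t ^/! n)
      if-zip true  = ≡.refl
      if-zip false = ≡.refl

  -- Decided by searching the finite edge list, so that refuting the second alternative yields an
  -- actual edge.
  multiple⊎≤1 : (∃[ e ] Edge e × 2 ℕ.≤ lookup e v) ⊎ (∀ {e} → Edge e → lookup e v ℕ.≤ 1)
  multiple⊎≤1 with Any.any? (λ e → 2 ℕ.≤? lookup e v) edges
  ... | yes ∃e with e , e∈ , 2≤m ← find ∃e =
    inj₁ (e , proj₂ (∈-filter⁻ edge? {xs = multisets order r} e∈) , 2≤m)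
  ... | no ∄e = inj₂ λ E → ℕ.≤-pred (ℕ.≰⇒> λ 2≤m → ∄e (lose (∈-edges P E) 2≤m))

  module _ (2≤r : 2 ℕ.≤ r) (v≤1 : ∀ {e} → Edge e → lookup e v ℕ.≤ 1)
           {y : Vertex → Carrier} (y-weighting : IsWeighting P y) (0<yv : 0# < y v) where
    private instance
      r≢0 : ℕ.NonZero r
      r≢0 = >-nonZero (ℕ.≤-trans (ℕ.s≤s ℕ.z≤n) 2≤r)

    ξ : Carrier
    ξ = y v / r

    uniformClones : Fin (Pattern.order (FR P v)) → Carrier
    uniformClones = w (λ _ → ξ) y

    uniformClones-isWeighting : IsWeighting (FR P v) uniformClones
    uniformClones-isWeighting =
      w-nonneg (λ _ → ξ) y (λ _ → /-nonneg (<⇒≤ 0<yv) r) (proj₁ y-weighting) , (≈.begin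
        sum uniformClones
          ≈.≈⟨ sum-w (λ _ → ξ) y ⟩
        sum (λ (_ : Fin r) → ξ) + sum (λ u → if does (u ≟ v) then 0# else y u)
          ≈.≈⟨ +-congʳ (trans (sum-constant r ξ) (ι*/ (y v) r)) ⟩
        y v + sum (λ u → if does (u ≟ v) then 0# else y u)
          ≈.≈⟨ sum-pull v y ⟩
        sum y
          ≈.≈⟨ proj₂ y-weighting ⟩
        1#
          ≈.∎)

    newEdge-pos : 0# < edgeWeight (FR P v) uniformClones newEdge
    newEdge-pos = <-respʳ-≈ (sym (edgeWeight-clonewise (λ _ → ξ) y (λ _ → 1) (λ _ → 0)))
      (*-pos (product-pos {r} _ λ _ → <-respʳ-≈ (sym (x^/!1≈x ξ)) (/-pos 0<yv r))
             (product-pos _ λ u → factor (does (u ≟ v)) (y u)))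
      where
      factor : ∀ d z → 0# < (if d then 1# else z ^/! 0)
      factor true  z = 0<1
      factor false z = <-respʳ-≈ (sym (x^/!0≈1 z)) 0<1

    -- For m = 1 the `r` clones contribute `ξ * others y e` each, and `ξ` taken `r` times is `y v`.
    -- For m ≥ 2 the divided power is not linear and these clones would lose weight.
    total-clones′ : ∀ m e → m ℕ.≤ 1 →
                    total (edgeWeight (FR P v) uniformClones) (clones′ m e) ≈ y v ^/! m * others y e
    total-clones′ 0 e _ = ≈.begin
      edgeWeight (FR P v) uniformClones (clonewise (λ _ → 0) (lookup e)) + 0#
        ≈.≈⟨ +-identityʳ _ ⟩
      edgeWeight (FR P v) uniformClones (clonewise (λ _ → 0) (lookup e))
        ≈.≈⟨ edgeWeight-clonewise (λ _ → ξ) y (λ _ → 0) (lookup e) ⟩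
      product (λ (_ : Fin r) → ξ ^/! 0) * others y e
        ≈.≈⟨ *-congʳ (trans (∏.sum-cong-≋ {r} λ _ → x^/!0≈1 ξ) (∏.sum-replicate-zero r)) ⟩
      1# * others y e
        ≈.≈⟨ *-congʳ (x^/!0≈1 (y v)) ⟨
      y v ^/! 0 * others y e
        ≈.∎
    total-clones′ 1 e _ = ≈.begin
      total (edgeWeight (FR P v) uniformClones) (clones′ 1 e)
        ≈.≈⟨ total-tabulate (edgeWeight (FR P v) uniformClones) clone ⟩
      sum (λ i → edgeWeight (FR P v) uniformClones (clone i))
        ≈.≈⟨ +∑.sum-cong-≋ weight-clone ⟩
      sum (λ (_ : Fin r) → ξ * others y e)
        ≈.≈⟨ sum-constant r (ξ * others y e) ⟩
      ι r * (ξ * others y e)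
        ≈.≈⟨ *-assoc _ _ _ ⟨
      ι r * ξ * others y e
        ≈.≈⟨ *-congʳ (trans (ι*/ (y v) r) (sym (x^/!1≈x (y v)))) ⟩
      y v ^/! 1 * others y e
        ≈.∎
      where
      clone : Fin r → Multiset (Pattern.order (FR P v))
      clone i = clonewise (δ 1 (toℕ i)) (lookup e)

      weight-clone : ∀ i → edgeWeight (FR P v) uniformClones (clone i) ≈ ξ * others y e
      weight-clone i = trans (edgeWeight-clonewise (λ _ → ξ) y (δ 1 (toℕ i)) (lookup e)) (*-congʳ
        (trans (product-single i _ λ j j≢i →
                 trans (reflexive (≡.cong (ξ ^/!_) (δ-other 1 (j≢i ∘ toℕ-injective)))) (x^/!0≈1 ξ))
               (trans (reflexive (≡.cong (ξ ^/!_) (δ-same 1 (toℕ i)))) (x^/!1≈x ξ))))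
    total-clones′ (suc (suc _)) _ (ℕ.s≤s ())

    weight<uniformClones : weight P y < weight (FR P v) uniformClones
    weight<uniformClones = <-≤-trans
      (<-respˡ-≈ (+-identityʳ _) (<-respʳ-≈ (+-comm _ _) (+-monoʳ-< (weight P y) newEdge-pos))) (begin
      edgeWeight (FR P v) uniformClones newEdge + weight P y
        ≈⟨ +-congˡ (total-concatMap (edgeWeight (FR P v) uniformClones) (edgeWeight P y) clones edges
             λ {e} e∈ → trans (total-clones′ (lookup e v) e
               (v≤1 (proj₂ (∈-filter⁻ edge? {xs = multisets order r} e∈)))) (edgeWeight-pull y e)) ⟨
      total (edgeWeight (FR P v) uniformClones) (cloneEdges 2≤r v≤1)
        ≲⟨ total≤weight (FR P v) (proj₁ uniformClones-isWeighting)
             (cloneEdges-unique 2≤r v≤1) (cloneEdges-edge 2≤r v≤1) ⟩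
      weight (FR P v) uniformClones
        ∎)

  ∃-multiple : 2 ℕ.≤ r → (∃[ w ] IsMaximalWeighting P w × 0# < w v) →
               ∀ {λP λFR} → IsLagrangian P λP → IsLagrangian (FR P v) λFR → λFR ≈ λP →
               ∃[ e ] Edge e × 2 ℕ.≤ lookup e v
  ∃-multiple 2≤r (y , (y-weighting , y-max) , 0<yv) {λP} {λFR}
             ((y₀ , y₀-weighting , weight≈λP) , _) (_ , weight≤λFR) λFR≈λP with multiple⊎≤1
  ... | inj₁ ∃e  = ∃e
  ... | inj₂ v≤1 = contradiction (weight<uniformClones 2≤r v≤1 y-weighting 0<yv) (begin
    weight (FR P v) (uniformClones 2≤r v≤1 y-weighting 0<yv)
      ≲⟨ weight≤λFR _ (uniformClones-isWeighting 2≤r v≤1 y-weighting 0<yv) ⟩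
    λFR          ≈⟨ λFR≈λP ⟩
    λP           ≈⟨ weight≈λP ⟨
    -- The weighting `y₀` that attains λ(P) may differ from the maximal weighting `y`; maximality of
    -- `y` compares them.
    weight P y₀  ≲⟨ y-max y₀ y₀-weighting ⟩
    weight P y   ∎)

-- The value of W at its maximum, by semiring identities.

module Optimum {c ℓ₁ ℓ₂} (ℝ : RealNumbers c ℓ₁ ℓ₂) where
  open RealNumbers ℝ hiding (zero)
  open OrderedField ℝ
  open import Relation.Binary.Reasoning.Setoid setoid
  open import Algebra.Properties.Group +-group using (∙-cancelʳ)

  -- Negation is the identity, as in `fromCommutativeSemiring`; the identities to be solved contain
  -- no subtraction.
  ℕ-rawRing : RawRing _ _
  ℕ-rawRing = record
    { Carrier = ℕ
    ; _≈_     = _≡_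
    ; _+_     = ℕ._+_
    ; _*_     = ℕ._*_
    ; -_      = id
    ; 0#      = 0
    ; 1#      = 1
    }

  ι-homomorphism : ℕ-rawRing -Raw-AlmostCommutative⟶ fromCommutativeSemiring commutativeSemiring
  ι-homomorphism = record
    { ⟦_⟧    = ι
    ; +-homo = ι-homo-+
    ; *-homo = ι-homo-*
    ; -‿homo = λ _ → refl
    ; 0-homo = refl
    ; 1-homo = +-identityʳ 1#
    }

  ι-weaklyDec : ∀ m n → Maybe (ι m ≈ ι n)
  ι-weaklyDec m n = Maybe.map (λ { ≡.refl → refl }) (dec⇒weaklyDec ℕ._≟_ m n)

  -- Unlike Algebra.Solver.Ring.NaturalCoefficients, this instance of the
  -- solver interprets con n as ι n.
  open RingSolver ℕ-rawRing (fromCommutativeSemiring commutativeSemiring) ι-homomorphism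
    ι-weaklyDec
    using (solve; con; _:+_; _:*_; _:=_)

  -- Modulo 11t² + 6t = 1, which t = (2√5 - 3)/11 satisfies, the optimal a and y
  -- are polynomials in t with nonnegative coefficients, so that the evaluation
  -- of W is a semiring computation.  Here h stands for a²/2.
  module _ {t} (11t²+6t≈1 : ι 11 * (t * t) + ι 6 * t ≈ 1#) where
    -- These are 2a = 1 - t and 2y = 1 - 3t with 1 replaced by 11t² + 6t, which removes the signs
    -- and makes nonnegativity evident.
    module _ {a y} (2a≈ : ι 2 * a ≈ t * (ι 11 * t + ι 5))
                   (2y≈ : ι 2 * y ≈ t * (ι 11 * t + ι 3)) where
      a+2t+y≈1 : a + (t + t) + y ≈ 1#
      a+2t+y≈1 = ι-*-cancelˡ-≈ 2 (begin
        ι 2 * (a + (t + t) + y)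
          ≈⟨ solve 3 (λ a t y → con 2 :* (a :+ (t :+ t) :+ y) :=
               con 2 :* a :+ con 4 :* t :+ con 2 :* y) refl a t y ⟩
        ι 2 * a + ι 4 * t + ι 2 * y
          ≈⟨ +-cong (+-congʳ 2a≈) 2y≈ ⟩
        t * (ι 11 * t + ι 5) + ι 4 * t + t * (ι 11 * t + ι 3)
          ≈⟨ solve 1 (λ t →
               t :* (con 11 :* t :+ con 5) :+ con 4 :* t :+ t :* (con 11 :* t :+ con 3) :=
               con 2 :* (con 11 :* (t :* t) :+ con 6 :* t)) refl t ⟩
        ι 2 * (ι 11 * (t * t) + ι 6 * t)
          ≈⟨ *-congˡ 11t²+6t≈1 ⟩
        ι 2 * 1#
          ∎)

      -- A polynomial in t reduces modulo 11t² + 6t = 1 to a linear one. The factor 8 · 22 = 11 · 16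
      -- clears the four halves in h · y.
      22W≈1+5t : ∀ {h} → ι 2 * h ≈ a * a →
                 ι 22 * (h * y + (a * t * y + (a * t * y + (t * t * y + a * t * t)))) ≈ 1# + ι 5 * t
      22W≈1+5t {h} 2h≈ = ι-*-cancelˡ-≈ 8 (begin
        ι 8 * (ι 22 * (h * y + (a * t * y + (a * t * y + (t * t * y + a * t * t)))))
          ≈⟨ solve 4 (λ a t y h →
               con 8 :* (con 22 :* (h :* y :+ (a :* t :* y :+ (a :* t :* y :+
                 (t :* t :* y :+ a :* t :* t))))) :=
               con 88 :* (con 2 :* h :* y :+
                 (con 4 :* a :* t :* y :+ con 2 :* t :* t :* y :+ con 2 :* a :* t :* t)))
               refl a t y h ⟩
        ι 88 * (ι 2 * h * y + (ι 4 * a * t * y + ι 2 * t * t * y + ι 2 * a * t * t))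
          ≈⟨ *-congˡ (+-congʳ (*-congʳ 2h≈)) ⟩
        ι 88 * (a * a * y + (ι 4 * a * t * y + ι 2 * t * t * y + ι 2 * a * t * t))
          ≈⟨ solve 3 (λ a t y →
               con 88 :* (a :* a :* y :+
                 (con 4 :* a :* t :* y :+ con 2 :* t :* t :* y :+ con 2 :* a :* t :* t)) :=
               con 11 :* ((con 2 :* a) :* (con 2 :* a) :* (con 2 :* y) :+
                 con 8 :* ((con 2 :* a) :* t :* (con 2 :* y) :+ t :* t :* (con 2 :* y) :+
                           (con 2 :* a) :* t :* t)))
               refl a t y ⟩
        ι 11 * (ι 2 * a * (ι 2 * a) * (ι 2 * y) +
          ι 8 * (ι 2 * a * t * (ι 2 * y) + t * t * (ι 2 * y) + ι 2 * a * t * t))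
          ≈⟨ *-congˡ (+-cong (*-cong (*-cong 2a≈ 2a≈) 2y≈)
               (*-congˡ (+-cong (+-cong (*-cong (*-congʳ 2a≈) 2y≈) (*-congˡ 2y≈))
                                (*-congʳ (*-congʳ 2a≈))))) ⟩
        _
          -- The cofactor of t³ is divided by 11t² + 6t: quotient 121t + 165, remainder 495t + 259.
          -- Replacing the divisor `1′` by 1 then lowers the degree.
          ≈⟨ solve 1 (λ t →
               let A = t :* (con 11 :* t :+ con 5); Y = t :* (con 11 :* t :+ con 3)
                   1′ = con 11 :* (t :* t) :+ con 6 :* t in
               con 11 :* (A :* A :* Y :+ con 8 :* (A :* t :* Y :+ t :* t :* Y :+ A :* t :* t)) :=
               con 11 :* (t :* t :* t :*
                 ((con 121 :* t :+ con 165) :* 1′ :+ con 495 :* t :+ con 259))) refl t ⟩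
        ι 11 * (t * t * t * ((ι 121 * t + ι 165) * (ι 11 * (t * t) + ι 6 * t) + ι 495 * t + ι 259))
          ≈⟨ *-congˡ (*-congˡ (+-congʳ (+-congʳ (*-congˡ 11t²+6t≈1)))) ⟩
        ι 11 * (t * t * t * ((ι 121 * t + ι 165) * 1# + ι 495 * t + ι 259))
          ≈⟨ *-congˡ (*-congˡ (+-congʳ (+-congʳ (*-identityʳ _)))) ⟩
        ι 11 * (t * t * t * (ι 121 * t + ι 165 + ι 495 * t + ι 259))
          -- The same reduction, now with one factor t taken back from t³ so that the coefficients
          -- stay natural numbers.
          ≈⟨ solve 1 (λ t →
               let 1′ = con 11 :* (t :* t) :+ con 6 :* t in
               con 11 :* (t :* t :* t :* (con 121 :* t :+ con 165 :+ con 495 :* t :+ con 259)) :=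
               con 88 :* (t :* t :* (con 7 :* 1′ :+ con 11 :* t))) refl t ⟩
        ι 88 * (t * t * (ι 7 * (ι 11 * (t * t) + ι 6 * t) + ι 11 * t))
          ≈⟨ *-congˡ (*-congˡ (+-congʳ (trans (*-congˡ 11t²+6t≈1) (*-identityʳ _)))) ⟩
        ι 88 * (t * t * (ι 7 + ι 11 * t))
          ≈⟨ solve 1 (λ t →
               let 1′ = con 11 :* (t :* t) :+ con 6 :* t in
               con 88 :* (t :* t :* (con 7 :+ con 11 :* t)) := con 88 :* (t :* (1′ :+ t))) refl t ⟩
        ι 88 * (t * (ι 11 * (t * t) + ι 6 * t + t))
          ≈⟨ *-congˡ (*-congˡ (+-congʳ 11t²+6t≈1)) ⟩
        ι 88 * (t * (1# + t))
          ≈⟨ *-congˡ (trans (distribˡ t 1# t) (+-congʳ (*-identityʳ t))) ⟩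
        ι 88 * (t + t * t)
          ≈⟨ solve 1 (λ t →
               let 1′ = con 11 :* (t :* t) :+ con 6 :* t in
               con 88 :* (t :+ t :* t) := con 8 :* (1′ :+ con 5 :* t)) refl t ⟩
        ι 8 * (ι 11 * (t * t) + ι 6 * t + ι 5 * t)
          ≈⟨ *-congˡ (+-congʳ 11t²+6t≈1) ⟩
        ι 8 * (1# + ι 5 * t)
          ∎)

  module _ {s} (0≤s : 0# ≤ s) (s²≈5 : s * s ≈ ι 5) where
    [2s]²≈20 : ι 2 * s * (ι 2 * s) ≈ ι 20
    [2s]²≈20 = begin
      ι 2 * s * (ι 2 * s)
        ≈⟨ solve 1 (λ s → con 2 :* s :* (con 2 :* s) := con 4 :* (s :* s)) refl s ⟩
      ι 4 * (s * s)
        ≈⟨ *-congˡ s²≈5 ⟩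
      ι 4 * ι 5
        ≈⟨ ι-homo-* 4 5 ⟨
      ι 20
        ∎

    t : Carrier
    t = (ι 2 * s - ι 3) / 11

    0≤t : 0# ≤ t
    0≤t = /-nonneg (x≤y⇒0≤y-x 3≤2s) 11
      where
      0≤2s : 0# ≤ ι 2 * s
      0≤2s = *-nonneg (0≤ι 2) 0≤s

      ι9<ι20 : ι 9 < ι 20
      ι9<ι20 = <-respˡ-≈ (+-identityʳ (ι 9))
        (<-respʳ-≈ (sym (ι-homo-+ 9 11)) (+-monoʳ-< (ι 9) (0<ι 11)))

      3≤2s : ι 3 ≤ ι 2 * s
      3≤2s 2s<3 = *-mono-≤ 0≤2s (0≤ι 3) (<⇒≤ 2s<3) (<⇒≤ 2s<3)
        (<-respˡ-≈ (ι-homo-* 3 3) (<-respʳ-≈ (sym [2s]²≈20) ι9<ι20))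

    11t+3≈2s : ι 11 * t + ι 3 ≈ ι 2 * s
    11t+3≈2s = trans (+-congʳ (ι*/ (ι 2 * s - ι 3) 11)) (x-y+y≈x (ι 2 * s) (ι 3))

    -- Completing the square: 11 (11t² + 6t) + 9 = (11t + 3)² = (2s)² = 20.
    11t²+6t≈1 : ι 11 * (t * t) + ι 6 * t ≈ 1#
    11t²+6t≈1 = ι-*-cancelˡ-≈ 11 (∙-cancelʳ (ι 9) _ _ (begin
      ι 11 * (ι 11 * (t * t) + ι 6 * t) + ι 9
        ≈⟨ solve 1 (λ t → con 11 :* (con 11 :* (t :* t) :+ con 6 :* t) :+ con 9 :=
             (con 11 :* t :+ con 3) :* (con 11 :* t :+ con 3)) refl t ⟩
      (ι 11 * t + ι 3) * (ι 11 * t + ι 3)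
        ≈⟨ *-cong 11t+3≈2s 11t+3≈2s ⟩
      ι 2 * s * (ι 2 * s)
        ≈⟨ [2s]²≈20 ⟩
      ι 20
        ≈⟨ ι-homo-+ 11 9 ⟩
      ι 11 + ι 9
        ≈⟨ +-congʳ (*-identityʳ (ι 11)) ⟨
      ι 11 * 1# + ι 9
        ∎))

    bound≈6W : ∀ {W} → ι 22 * W ≈ 1# + ι 5 * t → ι 6 / 121 * (ι 5 * s - ι 2) ≈ ι 6 * W
    bound≈6W {W} 22W≈ = ι-*-cancelˡ-≈ 121 (begin
      ι 121 * (ι 6 / 121 * (ι 5 * s - ι 2))
        ≈⟨ *-assoc (ι 121) (ι 6 / 121) (ι 5 * s - ι 2) ⟨
      ι 121 * (ι 6 / 121) * (ι 5 * s - ι 2)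
        ≈⟨ *-cong (ι*/ (ι 6) 121) 5s-2≈121W ⟩
      ι 6 * (ι 121 * W)
        ≈⟨ solve 2 (λ W k → con 6 :* (k :* W) := k :* (con 6 :* W)) refl W (ι 121) ⟩
      ι 121 * (ι 6 * W)
        ∎)
      where
      5s-2≈121W : ι 5 * s - ι 2 ≈ ι 121 * W
      -- Doubling and adding 4 turns the claim into 10s = 11 (1 + 5t) + 4, free of subtraction.
      5s-2≈121W = ι-*-cancelˡ-≈ 2 (∙-cancelʳ (ι 4) _ _ (begin
        ι 2 * (ι 5 * s - ι 2) + ι 4
          ≈⟨ solve 1 (λ d → con 2 :* d :+ con 4 := con 2 :* (d :+ con 2)) refl (ι 5 * s - ι 2) ⟩
        ι 2 * (ι 5 * s - ι 2 + ι 2)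
          ≈⟨ *-congˡ (x-y+y≈x (ι 5 * s) (ι 2)) ⟩
        ι 2 * (ι 5 * s)
          ≈⟨ solve 1 (λ s → con 2 :* (con 5 :* s) := con 5 :* (con 2 :* s)) refl s ⟩
        ι 5 * (ι 2 * s)
          ≈⟨ *-congˡ 11t+3≈2s ⟨
        ι 5 * (ι 11 * t + ι 3)
          ≈⟨ solve 1 (λ t → con 5 :* (con 11 :* t :+ con 3) :=
               con 11 :* (con 1 :+ con 5 :* t) :+ con 4) refl t ⟩
        ι 11 * (ι 1 + ι 5 * t) + ι 4
          ≈⟨ +-congʳ (*-congˡ (trans (+-congʳ (+-identityʳ 1#)) (sym 22W≈))) ⟩
        ι 11 * (ι 22 * W) + ι 4
          ≈⟨ solve 1 (λ W → con 11 :* (con 22 :* W) :+ con 4 :=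
               con 2 :* (con 121 :* W) :+ con 4) refl W ⟩
        ι 2 * (ι 121 * W) + ι 4
          ∎))

-- The values of a function on the copies of v when r = 3.
triple : ∀ {a} {A : Set a} → A → A → A → ℕ → A
triple x y z 0             = x
triple x y z 1             = y
triple x y z (suc (suc _)) = z

-- The case r = 3 with an edge {v,v,u}: five edges whose weights add up to W.

module Three {c ℓ₁ ℓ₂} (ℝ : RealNumbers c ℓ₁ ℓ₂) (P : Pattern 3) (v : Pattern.Vertex P) where
  open RealNumbers ℝ hiding (zero)
  open OrderedField ℝ
  open Lagrangian ℝ
  open Weights ℝ
  open Optimum ℝ
  open Pattern P
  open FranklRödl P v using (newEdge)
  open Clones P v
  open FRWeights ℝ P v
  open FiniteSum *-commutativeMonoid using () renaming (sum-single to product-single)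
  open FiniteSum +-commutativeMonoid using (sum-single)
  module ℕFinite = FiniteSum ℕ.+-0-commutativeMonoid
  import Relation.Binary.Reasoning.Setoid setoid as ≈
  open import Relation.Binary.Reasoning.Preorder ≤-preorder

  module _ {e} (E : Edge e) (ev≡2 : lookup e v ≡ 2) where
    rest : Vertex → ℕ
    rest u = if does (u ≟ v) then 0 else lookup e u

    ∑rest≡1 : ℕ∑.sum rest ≡ 1
    ∑rest≡1 = ℕ.+-cancelˡ-≡ 2 _ _ (≡.trans (≡.cong (ℕ._+ ℕ∑.sum rest) (≡.sym ev≡2))
                (≡.trans (ℕFinite.sum-pull v (lookup e)) (uniform E)))

    u : Vertex
    u = proj₁ (sum≡1⇒single rest ∑rest≡1)

    rest-u : rest u ≡ 1
    rest-u = proj₁ (proj₂ (sum≡1⇒single rest ∑rest≡1))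

    rest-other : ∀ w → w ≢ u → rest w ≡ 0
    rest-other = proj₂ (proj₂ (sum≡1⇒single rest ∑rest≡1))

    -- The edges {v₁,v₁,u}, {v₁,v₂,u}, {v₁,v₃,u}, {v₂,v₃,u} and {v₁,v₂,v₃}.
    e₂₀₀ e₁₁₀ e₁₀₁ e₀₁₁ : Multiset (Pattern.order (FR P v))
    e₂₀₀ = clonewise (triple 2 0 0) (lookup e)
    e₁₁₀ = clonewise (triple 1 1 0) (lookup e)
    e₁₀₁ = clonewise (triple 1 0 1) (lookup e)
    e₀₁₁ = clonewise (triple 0 1 1) (lookup e)

    fiveEdges : List (Multiset (Pattern.order (FR P v)))
    fiveEdges = e₂₀₀ ∷ e₁₁₀ ∷ e₁₀₁ ∷ e₀₁₁ ∷ newEdge ∷ []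

    triple-edge : ∀ p q s → q ℕ.≤ 1 → s ℕ.≤ 1 → p ℕ.+ (q ℕ.+ (s ℕ.+ 0)) ≡ 2 →
                  Pattern.Edge (FR P v) (clonewise (triple p q s) (lookup e))
    triple-edge p q s q≤1 s≤1 ∑≡2 = FR-edge (triple p q s) E (≡.trans ∑≡2 (≡.sym ev≡2))
      λ { 1 _ → q≤1 ; (suc (suc _)) _ → s≤1 }

    fiveEdges-edge : All (Pattern.Edge (FR P v)) fiveEdges
    fiveEdges-edge =
      triple-edge 2 0 0 ℕ.z≤n ℕ.z≤n ≡.refl ∷
      triple-edge 1 1 0 ℕ.≤-refl ℕ.z≤n ≡.refl ∷
      triple-edge 1 0 1 ℕ.z≤n ℕ.≤-refl ≡.refl ∷
      triple-edge 0 1 1 ℕ.≤-refl ℕ.≤-refl ≡.refl ∷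
      inj₂ ≡.refl ∷ []

    distinct : ∀ (a a′ : ℕ → ℕ) {b b′} (j : Fin 3) → a (toℕ j) ≢ a′ (toℕ j) →
               clonewise a b ≢ clonewise a′ b′
    distinct a a′ j aj≢ eq = aj≢ (clonewise-injective a a′ eq j)

    fiveEdges-unique : Unique fiveEdges
    fiveEdges-unique =
      (distinct (triple 2 0 0) (triple 1 1 0) 0F (λ ()) ∷
       distinct (triple 2 0 0) (triple 1 0 1) 0F (λ ()) ∷
       distinct (triple 2 0 0) (triple 0 1 1) 0F (λ ()) ∷
       distinct (triple 2 0 0) (λ _ → 1)      0F (λ ()) ∷ []) ∷
      (distinct (triple 1 1 0) (triple 1 0 1) 1F (λ ()) ∷
       distinct (triple 1 1 0) (triple 0 1 1) 0F (λ ()) ∷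
       distinct (triple 1 1 0) (λ _ → 1)      2F (λ ()) ∷ []) ∷
      (distinct (triple 1 0 1) (triple 0 1 1) 0F (λ ()) ∷
       distinct (triple 1 0 1) (λ _ → 1)      1F (λ ()) ∷ []) ∷
      (distinct (triple 0 1 1) (λ _ → 1)      0F (λ ()) ∷ []) ∷
      [] ∷ []

    module _ (a t η : Carrier) (0≤a : 0# ≤ a) (0≤t : 0# ≤ t) (0≤η : 0# ≤ η)
             (a+2t+η≈1 : a + (t + t) + η ≈ 1#) where
      y : Vertex → Carrier
      y w = if does (w ≟ u) then η else 0#

      y-u : y u ≡ η
      y-u = ≡.cong (if_then η else 0#) (dec-true (u ≟ u) ≡.refl)

      y-other : ∀ w → w ≢ u → y w ≡ 0#
      y-other w w≢u = ≡.cong (if_then η else 0#) (dec-false (w ≟ u) w≢u)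

      y-nonneg : ∀ w → 0# ≤ y w
      y-nonneg w with does (w ≟ u)
      ... | true  = 0≤η
      ... | false = ≤-reflexive refl

      triple-nonneg : ∀ j → 0# ≤ triple a t t j
      triple-nonneg 0             = 0≤a
      triple-nonneg 1             = 0≤t
      triple-nonneg (suc (suc _)) = 0≤t

      W : Fin (Pattern.order (FR P v)) → Carrier
      W = w (triple a t t) y

      u≢v : u ≢ v
      u≢v u≡v with () ← ≡.trans (≡.sym rest-u)
        (≡.cong (if_then 0 else lookup e u) (dec-true (u ≟ v) u≡v))

      W-isWeighting : IsWeighting (FR P v) W
      W-isWeighting = w-nonneg (triple a t t) y triple-nonneg y-nonneg , (≈.begin
        sum W
          ≈.≈⟨ sum-w (triple a t t) y ⟩
        a + (t + (t + 0#)) + sum (λ w → if does (w ≟ v) then 0# else y w)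
          ≈.≈⟨ +-cong (+-congˡ (+-congˡ (+-identityʳ t))) (sum-single u _ off) ⟩
        a + (t + t) + (if does (u ≟ v) then 0# else y u)
          ≈.≡⟨ ≡.cong₂ (λ d z → a + (t + t) + (if d then 0# else z)) (dec-false (u ≟ v) u≢v) y-u ⟩
        a + (t + t) + η
          ≈.≈⟨ a+2t+η≈1 ⟩
        1#
          ≈.∎)
        where
        off : ∀ w → w ≢ u → (if does (w ≟ v) then 0# else y w) ≈ 0#
        off w w≢u with does (w ≟ v)
        ... | true  = refl
        ... | false = reflexive (y-other w w≢u)

      others≈η : others y e ≈ η
      others≈η = ≈.begin
        others y e
          ≈.≈⟨ product-single u _ off ⟩
        (if does (u ≟ v) then 1# else y u ^/! lookup e u)
          ≈.≡⟨ ≡.cong (if_then 1# else y u ^/! lookup e u) (dec-false (u ≟ v) u≢v) ⟩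
        y u ^/! lookup e u
          ≈.≡⟨ ≡.cong₂ _^/!_ y-u (≡.trans (≡.sym rest≡eu) rest-u) ⟩
        η ^/! 1
          ≈.≈⟨ x^/!1≈x η ⟩
        η
          ≈.∎
        where
        rest≡eu : rest u ≡ lookup e u
        rest≡eu = ≡.cong (if_then 0 else lookup e u) (dec-false (u ≟ v) u≢v)

        -- A vertex outside e has weight 0 but also multiplicity 0, and 0^0 / 0! = 1.
        off : ∀ w → w ≢ u → (if does (w ≟ v) then 1# else y w ^/! lookup e w) ≈ 1#
        off w w≢u with does (w ≟ v) | rest-other w w≢u
        ... | true  | _    = refl
        ... | false | ew≡0 = trans (reflexive (≡.cong (y w ^/!_) ew≡0)) (x^/!0≈1 (y w))

      triple-weight : ∀ p q s {c} → a ^/! p * (t ^/! q * (t ^/! s * 1#)) ≈ c →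
                      edgeWeight (FR P v) W (clonewise (triple p q s) (lookup e)) ≈ c * η
      triple-weight p q s eq = trans
        (edgeWeight-clonewise (triple a t t) y (triple p q s) (lookup e)) (*-cong eq others≈η)

      private
        1*1*1 : 1# * (1# * 1#) ≈ 1#
        1*1*1 = trans (*-identityˡ _) (*-identityˡ _)

      weight-e₂₀₀ : edgeWeight (FR P v) W e₂₀₀ ≈ a ^/! 2 * η
      weight-e₂₀₀ = triple-weight 2 0 0 (trans
        (*-congˡ (trans (*-cong (x^/!0≈1 t) (*-congʳ (x^/!0≈1 t))) 1*1*1)) (*-identityʳ _))

      weight-e₁₁₀ : edgeWeight (FR P v) W e₁₁₀ ≈ a * t * η
      weight-e₁₁₀ = triple-weight 1 1 0 (*-cong (x^/!1≈x a) (trans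
        (*-cong (x^/!1≈x t) (trans (*-identityʳ _) (x^/!0≈1 t))) (*-identityʳ t)))

      weight-e₁₀₁ : edgeWeight (FR P v) W e₁₀₁ ≈ a * t * η
      weight-e₁₀₁ = triple-weight 1 0 1 (*-cong (x^/!1≈x a) (trans
        (*-cong (x^/!0≈1 t) (trans (*-identityʳ _) (x^/!1≈x t))) (*-identityˡ t)))

      weight-e₀₁₁ : edgeWeight (FR P v) W e₀₁₁ ≈ t * t * η
      weight-e₀₁₁ = triple-weight 0 1 1 (trans (*-cong (x^/!0≈1 a)
        (*-cong (x^/!1≈x t) (trans (*-identityʳ _) (x^/!1≈x t)))) (*-identityˡ _))

      weight-newEdge : edgeWeight (FR P v) W newEdge ≈ a * t * t
      weight-newEdge = ≈.begin
        edgeWeight (FR P v) W newEdge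
          ≈.≈⟨ edgeWeight-clonewise (triple a t t) y (λ _ → 1) (λ _ → 0) ⟩
        a ^/! 1 * (t ^/! 1 * (t ^/! 1 * 1#)) * product (λ w → if does (w ≟ v) then 1# else y w ^/! 0)
          ≈.≈⟨ *-cong (*-cong (x^/!1≈x a) (*-cong (x^/!1≈x t) (trans (*-identityʳ _) (x^/!1≈x t))))
                 (trans (∏.sum-cong-≋ {order} λ w → one (does (w ≟ v)) (y w))
                        (∏.sum-replicate-zero order)) ⟩
        a * (t * t) * 1#
          ≈.≈⟨ *-identityʳ _ ⟩
        a * (t * t)
          ≈.≈⟨ *-assoc a t t ⟨
        a * t * t
          ≈.∎
        where
        one : ∀ d z → (if d then 1# else z ^/! 0) ≈ 1#
        one true  z = refl
        one false z = x^/!0≈1 z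

      fiveEdges≤weight : a ^/! 2 * η + (a * t * η + (a * t * η + (t * t * η + a * t * t))) ≤
                         weight (FR P v) W
      fiveEdges≤weight = begin
        a ^/! 2 * η + (a * t * η + (a * t * η + (t * t * η + a * t * t)))
          ≈⟨ +-cong weight-e₂₀₀ (+-cong weight-e₁₁₀ (+-cong weight-e₁₀₁ (+-cong weight-e₀₁₁
               (trans (+-identityʳ _) weight-newEdge)))) ⟨
        total (edgeWeight (FR P v) W) fiveEdges
          ≲⟨ total≤weight (FR P v) (proj₁ W-isWeighting) fiveEdges-unique fiveEdges-edge ⟩
        weight (FR P v) W
          ∎

    bound≤6λ : ∀ {l} → IsLagrangian (FR P v) l → ∀ {s} → IsSqrt (ι 5) s →
               ι 6 / 121 * (ι 5 * s - ι 2) ≤ ι 6 * l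
    bound≤6λ {l} (_ , weight≤l) {s} (0≤s , s²≈5) = begin
      -- The divided power `a ^/! 2`, the contribution of {v₁,v₁} to its edge, is the h of
      -- `22W≈1+5t`.
      ι 6 / 121 * (ι 5 * s - ι 2)  ≈⟨ bound≈6W 0≤s s²≈5 (22W≈1+5t t-root (ι*/ _ 2) (ι*/ _ 2)
                                       (trans (ι*^/! a 2) (*-congˡ (*-identityʳ a)))) ⟩
      ι 6 * _                      ≲⟨ *-monoʳ-≤ (0≤ι 6) (≤ᴿ-trans
                                       (fiveEdges≤weight a t₀ η 0≤a 0≤t₀ 0≤η sum≈1)
                                       (weight≤l _ (W-isWeighting a t₀ η 0≤a 0≤t₀ 0≤η sum≈1))) ⟩
      ι 6 * l                      ∎
      where
      t₀ a η : Carrier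
      t₀ = t 0≤s s²≈5
      a  = t₀ * (ι 11 * t₀ + ι 5) / 2
      η  = t₀ * (ι 11 * t₀ + ι 3) / 2

      t-root : ι 11 * (t₀ * t₀) + ι 6 * t₀ ≈ 1#
      t-root = 11t²+6t≈1 0≤s s²≈5

      0≤t₀ : 0# ≤ t₀
      0≤t₀ = 0≤t 0≤s s²≈5

      0≤t[11t+n]/2 : ∀ n → 0# ≤ t₀ * (ι 11 * t₀ + ι n) / 2
      0≤t[11t+n]/2 n = /-nonneg (*-nonneg 0≤t₀ (+-nonneg (*-nonneg (0≤ι 11) 0≤t₀) (0≤ι n))) 2

      0≤a = 0≤t[11t+n]/2 5
      0≤η = 0≤t[11t+n]/2 3

      sum≈1 : a + (t₀ + t₀) + η ≈ 1#
      sum≈1 = a+2t+y≈1 t-root (ι*/ _ 2) (ι*/ _ 2)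

theorem4p3 :
  ∀ {c ℓ₁ ℓ₂} (ℝ : RealNumbers c ℓ₁ ℓ₂) →
  let open RealNumbers ℝ
      open Lagrangian ℝ
  in
  ∀ (r : ℕ) (3≤r : 3 ℕ.≤ r) (P : Pattern r) (v : Pattern.Vertex P) →
  (∃[ w ] IsMaximalWeighting P w × 0# < w v) →
  ∀ (λP λFR : Carrier) →
  IsLagrangian P λP → IsLagrangian (FR P v) λFR → λFR ≈ λP →
  let α = ι (r !) * λP in
  α < 1# →
  (r ≡ 3 → ∀ (√5 : Carrier) → IsSqrt (ι 5) √5 →
    ι 6 / 121 * (ι 5 * √5 - ι 2) ≤ α) ×
  (4 ℕ.≤ r →
    let instance
          r^r≢0 : ℕ.NonZero (r ℕ.^ r)
          r^r≢0 = m^n≢0 r r {{>-nonZero (≤-trans (ℕ.s≤s ℕ.z≤n) 3≤r)}}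
    in
    ι (2 ℕ.* r !) / (r ℕ.^ r) ≤ α)
theorem4p3 ℝ r 3≤r P v w-max λP λFR lagr-P lagr-FR λFR≈λP α<1 = part-i , part-ii
  where
  open RealNumbers ℝ hiding (zero)
  open OrderedField ℝ
  open Weights ℝ
  open Pattern P
  open import Relation.Binary.Reasoning.Preorder ≤-preorder

  instance
    r≢0 : ℕ.NonZero r
    r≢0 = >-nonZero (ℕ.≤-trans (ℕ.s≤s ℕ.z≤n) 3≤r)

  ∃e : ∃[ e ] Edge e × 2 ℕ.≤ lookup e v
  ∃e = FRWeights.∃-multiple ℝ P v (ℕ.≤-trans (ℕ.n≤1+n 2) 3≤r) w-max lagr-P lagr-FR λFR≈λP

  part-i : r ≡ 3 → ∀ √5 → IsSqrt (ι 5) √5 → ι 6 / 121 * (ι 5 * √5 - ι 2) ≤ ι (r !) * λP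
  part-i ≡.refl √5 is-√5 with e , E , 2≤m ← ∃e with ℕ.m≤n⇒m<n∨m≡n 2≤m
  ... | inj₁ 2<m = contradiction α<1 (r!λ≥1 P E lagr-P
          (ℕ.≤-antisym (ℕ.≤-trans (term≤sum (lookup e) v) (ℕ.≤-reflexive (uniform E))) 2<m))
  -- The five edges bound λ(FR); the assumed equality of Lagrangians carries the bound over to λ(P).
  ... | inj₂ 2≡m = ≤ᴿ-trans (Three.bound≤6λ ℝ P v E (≡.sym 2≡m) lagr-FR is-√5)
          (≤-reflexive (*-congˡ λFR≈λP))

  part-ii : 4 ℕ.≤ r → _/_ (ι (2 ℕ.* r !)) (r ℕ.^ r) {{ m^n≢0 r r }} ≤ ι (r !) * λP
  part-ii _ with e , E , 2≤m ← ∃e = ι-*-cancelˡ-≤ (r ℕ.^ r) {{ m^n≢0 r r }} (begin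
    ι (r ℕ.^ r) * _/_ (ι (2 ℕ.* r !)) (r ℕ.^ r) {{ m^n≢0 r r }}
                                   ≈⟨ ι*/ _ (r ℕ.^ r) {{ m^n≢0 r r }} ⟩
    ι (2 ℕ.* r !)                  ≡⟨ ≡.cong ι (ℕ.*-comm 2 (r !)) ⟩
    ι (r ! ℕ.* 2)                  ≈⟨ ι-homo-* (r !) 2 ⟩
    ι (r !) * ι 2                  ≲⟨ *-monoʳ-≤ (0≤ι (r !)) (2≤ι[r^r]*λ P E lagr-P 2≤m) ⟩
    ι (r !) * (ι (r ℕ.^ r) * λP)   ≈⟨ x∙yz≈y∙xz *-commutativeSemigroup _ _ _ ⟩
    ι (r ℕ.^ r) * (ι (r !) * λP)   ∎)
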